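{- The logic $\mathsf{C2.F}$ is sound and weakly complete for ordinal sequence models, and in fact for ordinal sequence models which are finite, closed under non-empty tailhood, and in which every sequence has length less than $\omega^\omega$. That is: (i) if $\vdash_{\mathsf{C2.F}}p$ then $p$ is true at every sequence in every ordinal sequence model; and (ii) for every $p\in\mathcal{L}_>$, if $p$ is true at every sequence in every ordinal sequence model $\langle W,\prec^W,V\rangle$ such that $W$ is finite, $W$ contains every non-empty tail of each of its members, and every member of $W$ has length less than $\omega^\omega$, then $\vdash_{\mathsf{C2.F}}p$.
   Context: Language. Let $At=\{p_0,p_1,\ldots\}$ be a countably infinite set of atoms. $\mathcal{L}_>$ is generated by $p ::= p_k\in At\mid \neg p\mid (p\wedge p)\mid (p>p)$; $\vee,\to,\leftrightarrow$ are defined as usual. Logics. $\mathsf{C2}$ is the smallest set of $\mathcal{L}_>$-sentences containing all instances of: (PC) every (substitution instance of a) theorem of classical propositional logic; (Identity) $p>p$; (Reciprocity) $(p>q)\wedge(q>p)\wedge(p>r)\to(q>r)$; (MP) $(p>q)\to(p\to q)$; (CEM) $(p>q)\vee(p>\neg q)$; and closed under (Detachment) from $\vdash p\to q$ and $\vdash p$ infer $\vdash q$; (Normality) from $\vdash(p\wedge q)\to r$ infer $\vdash((s>p)\wedge(s>q))\to(s>r)$. $\mathsf{C2.F}$ is the smallest extension of $\mathsf{C2}$ containing every instance of (Flattening) $(p>((p\wedge q)>r))\leftrightarrow((p\wedge q)>r)$ and closed under Detachment and Normality. $\vdash_{\mathsf{C2.F}}p$ means $p\in\mathsf{C2.F}$.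 Order frames and models. An order frame is a pair $\langle W,<\rangle$ where $W\neq\varnothing$ and $<$ is a function taking each $w\in W$ to a strict well-order $<_w$ on some subset of $W$ such that whenever $x<_w y$, either $w=x$ or $w<_w x$. Put $R(w)=\{w\}\cup\{v: w<_w v\}$. An order model $\langle W,<,V\rangle$ adds a valuation $V:At\times W\to\{0,1\}$; put $V(p_k)=\{w:V(p_k,w)=1\}$. Denotations: $[\![p_k]\!]=V(p_k)$, $[\![\neg p]\!]=W\setminus[\![p]\!]$, $[\![p\wedge q]\!]=[\![p]\!]\cap[\![q]\!]$, and $w\in[\![p>q]\!]$ iff either $R(w)\cap[\![p]\!]=\varnothing$, or there is $y\in R(w)\cap[\![p]\!]\cap[\![q]\!]$ such that $x\notin[\![p]\!]$ whenever $x<_w y$. A sentence $p$ is true at $w$ iff $w\in[\![p]\!]$. Ordinal sequences. For an ordinal $\alpha$ and non-empty set $P$, an $\alpha$-sequence over $P$ is a function $\sigma:\alpha\to P$; $\alpha$ is its length. An ordinal sequence is an $\alpha$-sequence for some ordinal $\alpha$. For $\beta\le\alpha$ the $\beta$th tail $\sigma^{[\beta:]}$ is the sequence of length $\alpha-\beta$ with $\sigma^{[\beta:]}(\gamma)=\sigma(\beta+\gamma)$; the rank in $\sigma$ of a tail $\tau$ of $\sigma$ is the least $\beta$ with $\tau=\sigma^{[\beta:]}$. The tail order function $\prec^W$ on a set $W$ of ordinal sequences has $\tau\prec^W_\sigma\rho$ iff $\tau,\rho,\sigma\in W$, $\tau$ and $\rho$ are tails of $\sigma$, and the rank of $\tau$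 in $\sigma$ is less than the rank of $\rho$ in $\sigma$. An ordinal sequence frame is an order frame $\langle W,\prec^W\rangle$ where $W$ is a set of ordinal sequences (finite or transfinite; $W$ is not required to be closed under tails or to exclude the empty sequence). An ordinal sequence model is an order model based on an ordinal sequence frame. -}

module Defs where

open import Data.Bool.Base as Bool using (Bool; true)
open import Data.List.Base using (List)
open import Data.List.Relation.Unary.Enumerates.Setoid using (IsEnumeration)
open import Data.Nat.Base as ℕ using (ℕ; zero; suc; s≤s; z≤n)
import Data.Nat.Properties as ℕ
import Data.Nat.Induction as ℕ
open import Data.Product.Base using (Σ-syntax; ∃; ∃-syntax; _×_; _,_; proj₁; proj₂)
open import Data.Product.Relation.Binary.Lex.Strict using (×-Lex; ×-wellFounded)
open import Data.Sum.Base using (_⊎_; inj₁; inj₂)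
open import Function.Base using (_∘_; _on_; id)
open import Function.Bundles using (Func; _⟨$⟩_)
open import Induction.WellFounded using (WellFounded; Acc; acc; module Subrelation)
open import Level using (Level; _⊔_; Lift; 0ℓ)
open import Relation.Binary.Bundles using (Setoid)
import Relation.Binary.Construct.Add.Supremum.Strict as AddSupremum
import Relation.Binary.Construct.On as On
open import Relation.Binary.Core using (Rel)
open import Relation.Binary.Definitions using (_Respects_; Transitive; Trichotomous; tri<; tri≈; tri>)
open import Relation.Binary.Morphism.Structures using (IsOrderIsomorphism)
open import Relation.Binary.PropositionalEquality as ≡ using (_≡_; refl; sym; trans; subst)
open import Relation.Binary.Structures using (IsStrictTotalOrder)
open import Relation.Nullary.Construct.Add.Supremum using (_⁺; [_])
open import Relation.Nullary.Negation.Core using (¬_; contradiction)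
open import Relation.Unary using (Pred; _∈_; ∁; _∩_; Empty)

private
  variable
    a b c ℓ ℓ₁ ℓ₂ : Level

------------------------------------------------------------------------
-- Language

infix  30 ∼_
infixr 25 _>_
infixr 24 _∧_
infixr 23 _∨_
infixr 22 _⇒_
infix  21 _⇔_

data Formula : Set where
  atom : ℕ → Formula
  ∼_   : Formula → Formula
  _∧_  : Formula → Formula → Formula
  _>_  : Formula → Formula → Formula

_∨_ _⇒_ _⇔_ : Formula → Formula → Formula
p ∨ q = ∼ (∼ p ∧ ∼ q)
p ⇒ q = ∼ (p ∧ ∼ q)
p ⇔ q = (p ⇒ q) ∧ (q ⇒ p)

------------------------------------------------------------------------
-- Logics

-- The theorems of classical propositional logic are taken to be the
-- two-valued tautologies.
data PropFormula : Set where
  var  : ℕ → PropFormula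
  neg  : PropFormula → PropFormula
  conj : PropFormula → PropFormula → PropFormula

eval : (ℕ → Bool) → PropFormula → Bool
eval v (var k)    = v k
eval v (neg φ)    = Bool.not (eval v φ)
eval v (conj φ ψ) = eval v φ Bool.∧ eval v ψ

Tautology : PropFormula → Set
Tautology φ = ∀ v → eval v φ ≡ true

substitute : (ℕ → Formula) → PropFormula → Formula
substitute s (var k)    = s k
substitute s (neg φ)    = ∼ substitute s φ
substitute s (conj φ ψ) = substitute s φ ∧ substitute s ψ

data C2 : Pred Formula 0ℓ where
  PC          : ∀ φ s → Tautology φ → C2 (substitute s φ)
  Identity    : ∀ p → C2 (p > p)
  Reciprocity : ∀ p q r → C2 ((p > q) ∧ (q > p) ∧ (p > r) ⇒ (q > r))
  MP          : ∀ p q → C2 ((p > q) ⇒ (p ⇒ q))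
  CEM         : ∀ p q → C2 ((p > q) ∨ (p > ∼ q))
  Detachment  : ∀ {p q} → C2 (p ⇒ q) → C2 p → C2 q
  Normality   : ∀ {p q r} s → C2 (p ∧ q ⇒ r) → C2 ((s > p) ∧ (s > q) ⇒ (s > r))

data C2F : Pred Formula 0ℓ where
  fromC2     : ∀ {p} → C2 p → C2F p
  Flattening : ∀ p q r → C2F ((p > ((p ∧ q) > r)) ⇔ ((p ∧ q) > r))
  Detachment : ∀ {p q} → C2F (p ⇒ q) → C2F p → C2F q
  Normality  : ∀ {p q r} s → C2F (p ∧ q ⇒ r) → C2F ((s > p) ∧ (s > q) ⇒ (s > r))

infix 4 ⊢C2F_

⊢C2F_ : Formula → Set
⊢C2F p = p ∈ C2F

------------------------------------------------------------------------
-- Order frames and models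

record IsStrictWellOrder {A : Set a} (_≈_ : Rel A ℓ₁) (_<_ : Rel A ℓ₂) :
                         Set (a ⊔ ℓ₁ ⊔ ℓ₂) where
  field
    isStrictTotalOrder : IsStrictTotalOrder _≈_ _<_
    wellFounded        : WellFounded _<_

  open IsStrictTotalOrder isStrictTotalOrder public

record IsOrderFrame (W : Setoid c ℓ)
                    (_<[_]_ : (x w y : Setoid.Carrier W) → Set ℓ) :
                    Set (Level.suc (c ⊔ ℓ)) where
  open Setoid W using (_≈_) renaming (Carrier to World)
  field
    nonEmpty : World
    cong     : ∀ {w w′ x x′ y y′} → w ≈ w′ → x ≈ x′ → y ≈ y′ →
               x <[ w ] y → x′ <[ w′ ] y′

    -- <_w is a strict well-order on the subset `field′ w`.
    field′    : World → Pred World (c ⊔ ℓ)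
    respects  : ∀ w → (field′ w) Respects _≈_
    within    : ∀ {w x y} → x <[ w ] y → x ∈ field′ w × y ∈ field′ w
    wellOrder : ∀ w → IsStrictWellOrder {A = ∃ (field′ w)}
                        (_≈_ on proj₁) ((λ x y → x <[ w ] y) on proj₁)

    centred   : ∀ {w x y} → x <[ w ] y → w ≈ x ⊎ w <[ w ] x

record OrderModel c ℓ : Set (Level.suc (c ⊔ ℓ)) where
  field
    W            : Setoid c ℓ
    _<[_]_       : (x w y : Setoid.Carrier W) → Set ℓ
    isOrderFrame : IsOrderFrame W _<[_]_
  open Setoid W public using (_≈_) renaming (Carrier to World)
  field
    V            : ℕ → World → Bool
    V-cong       : ∀ k {w w′} → w ≈ w′ → V k w ≡ V k w′

  R : World → Pred World ℓ
  R w v = w ≈ v ⊎ w <[ w ] v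

  ⟦_⟧ : Formula → Pred World (c ⊔ ℓ)
  ⟦ atom k ⟧ = λ w → Lift (c ⊔ ℓ) (V k w ≡ true)
  ⟦ ∼ p    ⟧ = ∁ ⟦ p ⟧
  ⟦ p ∧ q  ⟧ = ⟦ p ⟧ ∩ ⟦ q ⟧
  ⟦ p > q  ⟧ = λ w →
    Empty (R w ∩ ⟦ p ⟧)
    ⊎ (∃[ y ] y ∈ (R w ∩ ⟦ p ⟧ ∩ ⟦ q ⟧) × (∀ x → x <[ w ] y → ¬ (x ∈ ⟦ p ⟧)))

------------------------------------------------------------------------
-- Ordinals

-- An ordinal is represented by a well-ordered setoid; two of these stand
-- for the same ordinal when they are order-isomorphic.
record Ordinal ℓ : Set (Level.suc ℓ) where
  infix 4 _≈_ _<_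
  field
    Carrier           : Set ℓ
    _≈_               : Rel Carrier ℓ
    _<_               : Rel Carrier ℓ
    isStrictWellOrder : IsStrictWellOrder _≈_ _<_

  open IsStrictWellOrder isStrictWellOrder public

  setoid : Setoid ℓ ℓ
  setoid = record { isEquivalence = isEquivalence }

  -- The ordinals ≤ this one: [ x ] is the order type of the elements below
  -- x, and the added greatest element ⊤⁺ is this ordinal itself.
  Cut : Set ℓ
  Cut = Carrier ⁺

  open AddSupremum _<_ public using (_<⁺_)

restrict : (α : Ordinal ℓ) → Pred (Ordinal.Carrier α) ℓ → Ordinal ℓ
restrict α S = record
  { Carrier           = ∃ S
  ; _≈_               = α._≈_ on proj₁
  ; _<_               = α._<_ on proj₁
  ; isStrictWellOrder = record
    { isStrictTotalOrder = On.isStrictTotalOrder proj₁ α.isStrictTotalOrder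
    ; wellFounded        = On.wellFounded proj₁ α.wellFounded
    }
  }
  where module α = Ordinal α

initial : (α : Ordinal ℓ) → Ordinal.Carrier α → Ordinal ℓ
initial α b = restrict α (λ x → Ordinal._<_ α x b)

-- The ordinal α − β for β ≤ α: the position γ of α − β is the element
-- β + γ of α, so α − β is the part of α from β on.
final : (α : Ordinal ℓ) → Ordinal.Cut α → Ordinal ℓ
final α β = restrict α (λ x → ¬ (Ordinal._<⁺_ α [ x ] β))

record _≅_ (α : Ordinal ℓ₁) (β : Ordinal ℓ₂) : Set (ℓ₁ ⊔ ℓ₂) where
  private
    module α = Ordinal α
    module β = Ordinal β
  field
    to                 : α.Carrier → β.Carrier
    isOrderIsomorphism : IsOrderIsomorphism α._≈_ β._≈_ α._<_ β._<_ to

_<ᴼ_ : Ordinal ℓ₁ → Ordinal ℓ₂ → Set (ℓ₁ ⊔ ℓ₂)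
α <ᴼ β = ∃[ b ] α ≅ initial β b

-- Ordinal exponentiation: ω ^ ω is the set of finitely supported functions
-- ω → ω, where f precedes g iff f n < g n at the greatest n at which they
-- differ.
module ω^ω where

  FiniteSupport : Pred (ℕ → ℕ) 0ℓ
  FiniteSupport f = ∃[ N ] (∀ m → N ℕ.≤ m → f m ≡ 0)

  _≐_ : Rel (ℕ → ℕ) 0ℓ
  f ≐ g = ∀ n → f n ≡ g n

  _≺_ : Rel (ℕ → ℕ) 0ℓ
  f ≺ g = ∃[ n ] f n ℕ.< g n × (∀ m → n ℕ.< m → f m ≡ g m)

  private

    irrefl : ∀ {f g} → f ≐ g → ¬ (f ≺ g)
    irrefl f≐g (n , fn<gn , _) = ℕ.<-irrefl (f≐g n) fn<gn

    ≺-trans : Transitive _≺_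
    ≺-trans (n , p , e) (m , q , d) with ℕ.<-cmp n m
    ... | tri< n<m _ _  = m , subst (ℕ._< _) (sym (e m n<m)) q
                            , λ k m<k → trans (e k (ℕ.<-trans n<m m<k)) (d k m<k)
    ... | tri≈ _ refl _ = n , ℕ.<-trans p q , λ k n<k → trans (e k n<k) (d k n<k)
    ... | tri> _ _ m<n  = n , subst (_ ℕ.<_) (d n m<n) p
                            , λ k n<k → trans (e k n<k) (d k (ℕ.<-trans m<n n<k))

    split : ∀ {f g : ℕ → ℕ} {N} → f N ≡ g N → (∀ m → N ℕ.< m → f m ≡ g m) →
            ∀ m → N ℕ.≤ m → f m ≡ g m
    split e es m N≤m with ℕ.m≤n⇒m<n∨m≡n N≤m
    ... | inj₁ N<m  = es m N<m
    ... | inj₂ refl = e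

    compareFrom : ∀ {f g} N → (∀ m → N ℕ.≤ m → f m ≡ g m) → f ≺ g ⊎ f ≐ g ⊎ g ≺ f
    compareFrom zero es = inj₂ (inj₁ λ n → es n z≤n)
    compareFrom {f} {g} (suc N) es with ℕ.<-cmp (f N) (g N)
    ... | tri< lt _ _ = inj₁ (N , lt , es)
    ... | tri≈ _ eq _ = compareFrom N (split eq es)
    ... | tri> _ _ gt = inj₂ (inj₂ (N , gt , λ m N<m → sym (es m N<m)))

    compare : Trichotomous {A = ∃ FiniteSupport} (_≐_ on proj₁) (_≺_ on proj₁)
    compare (f , N , zf) (g , M , zg)
      with compareFrom (N ℕ.⊔ M) (λ m le →
             trans (zf m (ℕ.≤-trans (ℕ.m≤m⊔n N M) le))
                   (sym (zg m (ℕ.≤-trans (ℕ.m≤n⊔m N M) le))))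
    ... | inj₁ lt        = tri< lt (λ e → irrefl e lt) (λ gt → irrefl (λ _ → refl) (≺-trans lt gt))
    ... | inj₂ (inj₁ eq) = tri≈ (irrefl eq) eq (irrefl (sym ∘ eq))
    ... | inj₂ (inj₂ gt) = tri> (λ lt → irrefl (λ _ → refl) (≺-trans lt gt)) (λ e → irrefl (sym ∘ e) gt) gt

    -- The comparison of the first N values only, which is well-founded for
    -- every N.
    _≺⟨_⟩_ : (ℕ → ℕ) → ℕ → (ℕ → ℕ) → Set
    f ≺⟨ N ⟩ g = ∃[ n ] n ℕ.< N × f n ℕ.< g n × (∀ m → n ℕ.< m → m ℕ.< N → f m ≡ g m)

    toLex : ∀ {N f g} → f ≺⟨ suc N ⟩ g →
            ×-Lex _≡_ ℕ._<_ (λ f g → f ≺⟨ N ⟩ g) (f N , f) (g N , g)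
    toLex {N} (n , s≤s n≤N , lt , es) with ℕ.m≤n⇒m<n∨m≡n n≤N
    ... | inj₁ n<N  = inj₂ (es N n<N ℕ.≤-refl , n , n<N , lt , λ m n<m m<N → es m n<m (ℕ.m<n⇒m<1+n m<N))
    ... | inj₂ refl = inj₁ lt

    ≺⟨⟩-wellFounded : ∀ N → WellFounded (λ f g → f ≺⟨ N ⟩ g)
    ≺⟨⟩-wellFounded zero    f = acc λ { (_ , () , _) }
    ≺⟨⟩-wellFounded (suc N) = Subrelation.wellFounded toLex
      (On.wellFounded (λ f → f N , f) (×-wellFounded ℕ.<-wellFounded (≺⟨⟩-wellFounded N)))

    wellFounded : WellFounded {A = ∃ FiniteSupport} (_≺_ on proj₁)
    wellFounded (f , N , zf) = go N f (N , zf) zf (≺⟨⟩-wellFounded N f)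
      where
      go : ∀ N f (fs : FiniteSupport f) → (∀ m → N ℕ.≤ m → f m ≡ 0) →
           Acc (λ f g → f ≺⟨ N ⟩ g) f → Acc (_≺_ on proj₁) (f , fs)
      go N f _ zf (acc rs) = acc λ { {g , gs} (n , lt , es) →
        let n<N = ℕ.≰⇒> λ N≤n → contradiction (subst (_ ℕ.<_) (zf n N≤n) lt) λ ()
        in go N g gs (λ m N≤m → trans (es m (ℕ.<-≤-trans n<N N≤m)) (zf m N≤m))
             (rs (n , n<N , lt , λ m n<m _ → es m n<m)) }

  ω^ω : Ordinal 0ℓ
  ω^ω = record
    { Carrier           = ∃ FiniteSupport
    ; _≈_               = _≐_ on proj₁
    ; _<_               = _≺_ on proj₁
    ; isStrictWellOrder = record
      { isStrictTotalOrder = record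
        { isStrictPartialOrder = record
          { isEquivalence = On.isEquivalence proj₁ (record
              { refl  = λ _ → refl
              ; sym   = λ e n → sym (e n)
              ; trans = λ e d n → trans (e n) (d n)
              })
          ; irrefl        = irrefl
          ; trans         = ≺-trans
          ; <-resp-≈      = (λ e → λ { (n , lt , es) → n , subst (_ ℕ.<_) (e n) lt
                                         , λ m n<m → trans (es m n<m) (e m) })
                          , (λ e → λ { (n , lt , es) → n , subst (ℕ._< _) (e n) lt
                                         , λ m n<m → trans (sym (e m)) (es m n<m) })
          }
        ; compare = compare
        }
      ; wellFounded = wellFounded
      }
    }

open ω^ω public using (ω^ω)

------------------------------------------------------------------------
-- Ordinal sequences

record Sequence {ℓ} (P : Set ℓ) : Set (Level.suc ℓ) where
  field
    length : Ordinal ℓ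
    values : Func (Ordinal.setoid length) (≡.setoid P)

open Sequence public

module _ {P : Set ℓ} where

  infix 4 _≋_

  -- Equality of sequences as functions on ordinals: the isomorphism between
  -- the lengths is unique, and says that they are the same ordinal.
  _≋_ : Rel (Sequence P) ℓ
  σ ≋ τ = Σ[ i ∈ length σ ≅ length τ ]
            (∀ x → values σ ⟨$⟩ x ≡ values τ ⟨$⟩ (_≅_.to i x))

  ≋-refl : ∀ {σ} → σ ≋ σ
  ≋-refl {σ} = record
    { to = id
    ; isOrderIsomorphism = record
      { isOrderMonomorphism = record
        { isOrderHomomorphism = record { cong = id ; mono = id }
        ; injective = id
        ; cancel    = id
        }
      ; surjective = λ y → y , id
      }
    } , λ _ → refl

  ≋-sym : ∀ {σ τ} → σ ≋ τ → τ ≋ σ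
  ≋-sym {σ} {τ} (i , e) = record
    { to = from
    ; isOrderIsomorphism = record
      { isOrderMonomorphism = record
        { isOrderHomomorphism = record
          { cong = λ {x} {y} x≈y → I.injective
              (T.Eq.trans (to-from x) (T.Eq.trans x≈y (T.Eq.sym (to-from y))))
          ; mono = λ {x} {y} x<y → I.cancel
              (T.<-respˡ-≈ (T.Eq.sym (to-from x)) (T.<-respʳ-≈ (T.Eq.sym (to-from y)) x<y))
          }
        ; injective = λ {x} {y} p →
            T.Eq.trans (T.Eq.sym (to-from x)) (T.Eq.trans (I.cong p) (to-from y))
        ; cancel = λ {x} {y} p →
            T.<-respˡ-≈ (to-from x) (T.<-respʳ-≈ (to-from y) (I.mono p))
        }
      ; surjective = λ x → to x , λ {z} p → I.injective (T.Eq.trans (to-from z) p)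
      }
    } , λ x → sym (trans (e (from x)) (Func.cong (values τ) (to-from x)))
    where
    module S = Ordinal (length σ)
    module T = Ordinal (length τ)
    open _≅_ i
    module I = IsOrderIsomorphism isOrderIsomorphism

    from : T.Carrier → S.Carrier
    from y = proj₁ (I.surjective y)

    to-from : ∀ y → to (from y) T.≈ y
    to-from y = proj₂ (I.surjective y) S.Eq.refl

  ≋-trans : ∀ {σ τ ρ} → σ ≋ τ → τ ≋ ρ → σ ≋ ρ
  ≋-trans {σ} {τ} {ρ} (i , e) (j , d) = record
    { to = J.to ∘ I.to
    ; isOrderIsomorphism = record
      { isOrderMonomorphism = record
        { isOrderHomomorphism = record { cong = JI.cong ∘ II.cong ; mono = JI.mono ∘ II.mono }
        ; injective = II.injective ∘ JI.injective
        ; cancel    = II.cancel ∘ JI.cancel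
        }
      ; surjective = λ z → let y , p = JI.surjective z ; x , q = II.surjective y in
          x , λ r → p (q r)
      }
    } , λ x → trans (e x) (d (I.to x))
    where
    module I  = _≅_ i
    module J  = _≅_ j
    module II = IsOrderIsomorphism I.isOrderIsomorphism
    module JI = IsOrderIsomorphism J.isOrderIsomorphism

  infix 10 _[_:]

  _[_:] : (σ : Sequence P) → Ordinal.Cut (length σ) → Sequence P
  σ [ β :] = record
    { length = final (length σ) β
    ; values = record { to   = λ x → values σ ⟨$⟩ proj₁ x
                      ; cong = Func.cong (values σ) }
    }

  NonEmpty : Sequence P → Set ℓ
  NonEmpty σ = Ordinal.Carrier (length σ)

  HasRank : (σ τ : Sequence P) → Ordinal.Cut (length σ) → Set ℓ
  HasRank σ τ β = τ ≋ σ [ β :] × (∀ β′ → Ordinal._<⁺_ (length σ) β′ β → ¬ (τ ≋ σ [ β′ :]))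

  -- A sequence has a rank in σ only if it is a tail of σ.
  TailBefore : (σ τ ρ : Sequence P) → Set ℓ
  TailBefore σ τ ρ = ∃[ β ] ∃[ γ ] HasRank σ τ β × HasRank σ ρ γ × Ordinal._<⁺_ (length σ) β γ

sequenceSetoid : (P : Set ℓ) → Setoid (Level.suc ℓ) ℓ
sequenceSetoid P = record
  { Carrier       = Sequence P
  ; _≈_           = _≋_
  ; isEquivalence = record
    { refl  = λ {σ} → ≋-refl {σ = σ}
    ; sym   = λ {σ} {τ} → ≋-sym {σ = σ} {τ}
    ; trans = λ {σ} {τ} {ρ} → ≋-trans {σ = σ} {τ} {ρ}
    }
  }

membersSetoid : {P : Set ℓ} → Pred (Sequence P) (Level.suc ℓ) → Setoid (Level.suc ℓ) ℓ
membersSetoid {P = P} W = On.setoid {B = ∃ W} (sequenceSetoid P) proj₁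

tailOrder : {P : Set ℓ} (W : Pred (Sequence P) (Level.suc ℓ)) → (τ σ ρ : ∃ W) → Set ℓ
tailOrder W (τ , _) (σ , _) (ρ , _) = TailBefore σ τ ρ

-- A set of sequences over various non-empty sets is a set of sequences over
-- their union, so one P serves for the whole of W.
record OrdinalSequenceModel ℓ : Set (Level.suc (Level.suc ℓ)) where
  field
    P            : Set ℓ
    P-nonEmpty   : P
    W            : Pred (Sequence P) (Level.suc ℓ)
    W-respects   : W Respects _≋_
    isOrderFrame : IsOrderFrame (membersSetoid W) (tailOrder W)
    V            : ℕ → ∃ W → Bool
    V-cong       : ∀ k {σ τ : ∃ W} → proj₁ σ ≋ proj₁ τ → V k σ ≡ V k τ

  orderModel : OrderModel (Level.suc ℓ) ℓ
  orderModel = record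
    { W            = membersSetoid W
    ; _<[_]_       = tailOrder W
    ; isOrderFrame = isOrderFrame
    ; V            = V
    ; V-cong       = λ k {σ} {τ} → V-cong k {σ} {τ}
    }

  TrueAtEvery : Formula → Set (Level.suc ℓ)
  TrueAtEvery p = ∀ σ → σ ∈ OrderModel.⟦_⟧ orderModel p

  Finite : Set (Level.suc ℓ)
  Finite = ∃ (IsEnumeration (membersSetoid W))

  ClosedUnderNonEmptyTails : Set (Level.suc ℓ)
  ClosedUnderNonEmptyTails = ∀ σ → σ ∈ W → ∀ β → NonEmpty (σ [ β :]) → σ [ β :] ∈ W

  LengthsBelow : Ordinal 0ℓ → Set (Level.suc ℓ)
  LengthsBelow α = ∀ σ → σ ∈ W → length σ <ᴼ α

{-# OPTIONS --safe #-}

-- A conditional p > q holds at a sequence σ iff q holds at the first tail of σ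
-- at which p holds, if there is one.  Tails of tails are tails, so the first
-- (p ∧ q)-tail of σ is also the first (p ∧ q)-tail of the first p-tail of σ;
-- this is Flattening, and the other axioms are immediate.
--
-- Conversely let φ be unprovable.  The states are the consistent complete
-- conjunctions of subformulas of φ and their negations; each state begins a
-- sequence of states, built by transfinite recursion.  If E collects the
-- formulas that have been false from some earlier entry d on, then the next
-- entry y is a state consistent with every ψ such that d proves ⋁E > ψ.
-- Flattening gives d and y the same conditionals p > q with p ∈ E, and some
-- p ∈ E holds at y.  Hence d proves p > q iff the first entry from d on that
-- proves p also proves q.  If d proves ⋁E > ⊥ then each p > q with p ∈ E is
-- vacuously true at d, and nothing more is demanded of the next entry.
--
-- The next entry after a block of length ω ^ k is chosen as a function of the
-- first entry of that block, and ω such blocks form a block of length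
-- ω ^ (k + 1).  Passing from ω ^ k to ω ^ (k + 1) removes one of the formulas
-- that are eventually false, so once k exceeds the number of subformulas
-- nothing is left open.  A tail is determined by the first entries of
-- the blocks in which it begins, so there are finitely many.

module Submission where

open import Defs
open import Axiom.ExcludedMiddle using (ExcludedMiddle)
open import Data.Bool.Base using (Bool; true; false; not; T) renaming (_∧_ to _∧ᵇ_)
open import Data.Bool.Properties using (T-≡; T-∧)
open import Data.List.Base using (List; []; _∷_; _++_; map; cartesianProductWith) renaming (length to ∣_∣)
open import Data.List.Membership.Propositional using () renaming (_∈_ to _∈ˡ_)
open import Data.List.Membership.Propositional.Properties
  using (∈-map⁺; ∈-map⁻; ∈-++⁺ˡ; ∈-++⁺ʳ; ∈-++⁻; ∈-cartesianProductWith⁺)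
open import Data.List.Relation.Unary.Any using (Any; here; there)
open import Data.Nat.Base as ℕ using (ℕ; zero; suc; _+_; s≤s; z≤n; _≤′_; ≤′-refl; ≤′-step)
open import Data.Nat.GeneralisedArithmetic using (fold; fold-+)
import Data.Nat.Induction as ℕ
import Data.Nat.Properties as ℕ
open import Data.Product.Base using (∃; ∃-syntax; Σ-syntax; _×_; _,_; proj₁; proj₂)
open import Data.Sum.Base using (_⊎_; inj₁; inj₂)
open import Data.Unit.Polymorphic.Base using (⊤; tt)
open import Data.Vec.Base using (Vec; []; _∷_; replicate)
open import Data.Vec.Relation.Binary.Lex.Strict
  using (Lex-<; this; next; <-isStrictTotalOrder; <-wellFounded; xs≮[])
open import Data.Vec.Relation.Binary.Pointwise.Inductive
  using (Pointwise; Pointwise-≡⇒≡; ≡⇒Pointwise-≡)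
open import Function.Base using (_∘_; id)
open import Function.Bundles using (Equivalence; _⟨$⟩_)
open import Induction.WellFounded using (WellFounded; Acc; acc; module Subrelation)
open import Level using (Level; _⊔_; Lift; lift; lower; 0ℓ) renaming (suc to lsuc)
open import Relation.Binary.Bundles using (Setoid)
import Relation.Binary.Construct.Add.Supremum.Equality as SupEquality
import Relation.Binary.Construct.Add.Supremum.Strict as SupStrict
import Relation.Binary.Construct.On as On
open import Relation.Binary.Core using (Rel)
open import Relation.Binary.Definitions using (Tri; tri<; tri≈; tri>)
open import Relation.Binary.Morphism.Structures using (IsOrderIsomorphism)
open import Relation.Binary.PropositionalEquality
  using (_≡_; _≢_; refl; sym; trans; cong; cong₂; subst; resp₂)
open import Relation.Binary.Structures using (IsStrictTotalOrder)
open import Relation.Nullary.Construct.Add.Supremum using ([_]; ⊤⁺)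
open import Relation.Nullary.Decidable.Core using (yes; no; does)
open import Relation.Nullary.Negation.Core using (¬_; contradiction)
open import Relation.Unary using (Pred)
open OrdinalSequenceModel using (TrueAtEvery; Finite; ClosedUnderNonEmptyTails; LengthsBelow)

private
  variable
    a ℓ ℓ₁ ℓ₂ : Level
    k : ℕ

-- Cuts of ordinals

module Cuts (α : Ordinal ℓ) where

  open Ordinal α using (Cut; _<⁺_; isStrictTotalOrder; wellFounded)
  open SupEquality (Ordinal._≈_ α) using (_≈⁺_) public

  open IsStrictTotalOrder (SupStrict.<⁺-isStrictTotalOrder (Ordinal._<_ α) isStrictTotalOrder) public
    using (compare; irrefl; <-respʳ-≈; <-respˡ-≈)
    renaming (trans to <⁺-trans; module Eq to ≈⁺)

  <⁺-wellFounded : WellFounded _<⁺_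
  <⁺-wellFounded [ x ] = go (wellFounded x)
    where
    go : ∀ {x} → Acc (Ordinal._<_ α) x → Acc _<⁺_ [ x ]
    go (acc rs) = acc λ { SupStrict.[ y<x ] → go (rs y<x) }
  <⁺-wellFounded ⊤⁺ = acc λ { SupStrict.[ y ]<⊤⁺ → <⁺-wellFounded [ y ] }

  ≮-<-trans : ∀ {β γ δ : Cut} → ¬ (γ <⁺ β) → γ <⁺ δ → β <⁺ δ
  ≮-<-trans {β} {γ} ≮ < with compare β γ
  ... | tri< β<γ _ _ = <⁺-trans β<γ <
  ... | tri≈ _ β≈γ _ = <-respˡ-≈ (≈⁺.sym β≈γ) <
  ... | tri> _ _ γ<β = contradiction γ<β ≮

  <-≮-trans : ∀ {β γ δ : Cut} → β <⁺ γ → ¬ (δ <⁺ γ) → β <⁺ δ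
  <-≮-trans {β} {γ} {δ} < ≮ with compare γ δ
  ... | tri< γ<δ _ _ = <⁺-trans < γ<δ
  ... | tri≈ _ γ≈δ _ = <-respʳ-≈ γ≈δ <
  ... | tri> _ _ δ<γ = contradiction δ<γ ≮

module _ (α : Ordinal ℓ₁) (β : Ordinal ℓ₂) where

  private
    module α = Ordinal α
    module β = Ordinal β

  -- Trichotomy in `α` yields injectivity and order reflection, so later isomorphisms only need
  -- congruence, monotonicity and surjectivity.
  strictMono⇒≅ : (f : α.Carrier → β.Carrier) →
                 (∀ {x y} → x α.≈ y → f x β.≈ f y) →
                 (∀ {x y} → x α.< y → f x β.< f y) →
                 (∀ y → ∃[ x ] f x β.≈ y) → α ≅ β
  strictMono⇒≅ f f-cong f-mono f-onto = record
    { to = f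
    ; isOrderIsomorphism = record
      { isOrderMonomorphism = record
        { isOrderHomomorphism = record { cong = f-cong ; mono = f-mono }
        ; injective = λ {x} {y} fx≈fy → injective x y fx≈fy
        ; cancel = λ {x} {y} fx<fy → cancel x y fx<fy
        }
      ; surjective = λ y → let x , fx≈y = f-onto y in
          x , λ z≈x → β.Eq.trans (f-cong z≈x) fx≈y
      }
    }
    where
    injective : ∀ x y → f x β.≈ f y → x α.≈ y
    injective x y fx≈fy with α.compare x y
    ... | tri< x<y _ _ = contradiction (f-mono x<y) (β.irrefl fx≈fy)
    ... | tri≈ _ x≈y _ = x≈y
    ... | tri> _ _ y<x = contradiction (f-mono y<x) (β.irrefl (β.Eq.sym fx≈fy))

    cancel : ∀ x y → f x β.< f y → x α.< y
    cancel x y fx<fy with α.compare x y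
    ... | tri< x<y _ _ = x<y
    ... | tri≈ _ x≈y _ = contradiction fx<fy (β.irrefl (f-cong x≈y))
    ... | tri> _ _ y<x = contradiction (f-mono y<x) (β.asym fx<fy)

-- Tails

module _ {P : Set ℓ} where

  -- _≋_ unfolds to a Σ-type, from which the sequences cannot be inferred.
  ≋-sym′ : ∀ (σ τ : Sequence P) → σ ≋ τ → τ ≋ σ
  ≋-sym′ σ τ = ≋-sym {σ = σ} {τ}

  ≋-trans′ : ∀ (σ τ ρ : Sequence P) → σ ≋ τ → τ ≋ ρ → σ ≋ ρ
  ≋-trans′ σ τ ρ = ≋-trans {σ = σ} {τ} {ρ}

  module _ (σ : Sequence P) where

    private
      module σ = Ordinal (length σ)
      module C = Cuts (length σ)

    tail-cong : ∀ {β γ} → β C.≈⁺ γ → σ [ β :] ≋ σ [ γ :]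
    tail-cong {β} {γ} β≈γ =
      strictMono⇒≅ _ _
        (λ { (x , x≮β) → x , x≮β ∘ C.<-respʳ-≈ (C.≈⁺.sym β≈γ) }) id id
        (λ { (x , x≮γ) → (x , x≮γ ∘ C.<-respʳ-≈ β≈γ) , σ.Eq.refl })
      , λ _ → refl

    module _ (β : σ.Cut) where

      private module T = Ordinal (length (σ [ β :]))

      -- This is ordinal addition `β + γ`: since `final` keeps the positions from `β` on, adding `β`
      -- amounts to dropping the proof of membership.
      forget : T.Cut → σ.Cut
      forget [ x , _ ] = [ x ]
      forget ⊤⁺        = ⊤⁺

      forget-≮ : ∀ γ → ¬ (forget γ σ.<⁺ β)
      forget-≮ [ _ , x≮β ] = x≮β
      forget-≮ ⊤⁺ ()

      forget-onto : ∀ γ → ¬ (γ σ.<⁺ β) → ∃[ γ′ ] forget γ′ ≡ γ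
      forget-onto [ x ] x≮β = [ x , x≮β ] , refl
      forget-onto ⊤⁺    _   = ⊤⁺ , refl

      forget-mono : ∀ {γ δ} → γ T.<⁺ δ → forget γ σ.<⁺ forget δ
      forget-mono SupStrict.[ x<y ]   = SupStrict.[ x<y ]
      forget-mono SupStrict.[ x ]<⊤⁺ = SupStrict.[ proj₁ x ]<⊤⁺

      forget-cancel : ∀ {γ δ} → forget γ σ.<⁺ forget δ → γ T.<⁺ δ
      forget-cancel {[ _ ]} {[ _ ]} SupStrict.[ x<y ]  = SupStrict.[ x<y ]
      forget-cancel {[ _ ]} {⊤⁺}    _ = SupStrict.[ _ ]<⊤⁺
      forget-cancel {⊤⁺}    {[ _ ]} ()
      forget-cancel {⊤⁺}    {⊤⁺}    ()

      -- A position from `forget γ` on lies from `β` on as well, so both sides keep the same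
      -- positions of `σ`.
      tail-tail : ∀ γ → (σ [ β :]) [ γ :] ≋ σ [ forget γ :]
      tail-tail γ =
        strictMono⇒≅ _ _
          (λ { (x , x≮γ) → proj₁ x , x≮γ ∘ forget-cancel })
          id id
          (λ { (x , x≮γ) → ((x , λ x<β → x≮γ (C.<-≮-trans x<β (forget-≮ γ))) , x≮γ ∘ forget-mono)
                         , σ.Eq.refl })
        , λ _ → refl

  module _ {σ τ : Sequence P} (σ≋τ : σ ≋ τ) where

    private
      module σ = Ordinal (length σ)
      module τ = Ordinal (length τ)
      i = proj₁ σ≋τ
      module I = IsOrderIsomorphism (_≅_.isOrderIsomorphism i)

    mapCut : σ.Cut → τ.Cut
    mapCut [ x ] = [ _≅_.to i x ]
    mapCut ⊤⁺    = ⊤⁺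

    mapCut-mono : ∀ {β γ} → β σ.<⁺ γ → mapCut β τ.<⁺ mapCut γ
    mapCut-mono SupStrict.[ x<y ]   = SupStrict.[ I.mono x<y ]
    mapCut-mono SupStrict.[ x ]<⊤⁺ = SupStrict.[ _ ]<⊤⁺

    mapCut-cancel : ∀ {β γ} → mapCut β τ.<⁺ mapCut γ → β σ.<⁺ γ
    mapCut-cancel {[ _ ]} {[ _ ]} SupStrict.[ x<y ] = SupStrict.[ I.cancel x<y ]
    mapCut-cancel {[ _ ]} {⊤⁺} _ = SupStrict.[ _ ]<⊤⁺
    mapCut-cancel {⊤⁺} {[ _ ]} ()
    mapCut-cancel {⊤⁺} {⊤⁺} ()

    mapCut-onto : ∀ γ → ∃[ β ] Cuts._≈⁺_ (length τ) (mapCut β) γ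
    mapCut-onto [ y ] = let x , p = I.surjective y in [ x ] , SupEquality.[ p σ.Eq.refl ]
    mapCut-onto ⊤⁺    = ⊤⁺ , SupEquality.⊤⁺≈⊤⁺

    tail-resp : ∀ β → σ [ β :] ≋ τ [ mapCut β :]
    tail-resp β =
      strictMono⇒≅ _ _
        (λ { (x , x≮β) → _≅_.to i x , x≮β ∘ mapCut-cancel })
        I.cong I.mono
        (λ { (y , y≮β) → let x , p = I.surjective y in
             (x , λ x<β → y≮β (Cuts.<-respˡ-≈ (length τ) SupEquality.[ p σ.Eq.refl ] (mapCut-mono x<β)))
             , p σ.Eq.refl })
      , proj₂ σ≋τ ∘ proj₁

-- Ranks of tails and the order frame they induce

module Classical (em : ∀ {a} → ExcludedMiddle a) where

  minimal : ∀ {a r s} {A : Set a} {_<_ : Rel A r} → WellFounded _<_ → (S : Pred A s) →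
            ∃ S → ∃[ x ] S x × (∀ y → y < x → ¬ S y)
  minimal {A = A} {_<_} wf S (x , Sx) = go x Sx (wf x)
    where
    go : ∀ x → S x → Acc _<_ x → ∃[ x ] S x × (∀ y → y < x → ¬ S y)
    go x Sx (acc rs) with em {P = ∃[ y ] y < x × S y}
    ... | yes (y , y<x , Sy) = go y Sy (rs y<x)
    ... | no none            = x , Sx , λ y y<x Sy → none (y , y<x , Sy)

  module _ {P : Set ℓ} where

    -- The least cut is position zero, or `⊤⁺` if `σ` is empty; starting the search at `⊤⁺` covers
    -- both cases.
    bottom : (σ : Sequence P) →
             ∃[ β ] (∀ γ → ¬ Ordinal._<⁺_ (length σ) γ β) × σ ≋ σ [ β :]
    bottom σ with minimal (Cuts.<⁺-wellFounded (length σ)) (λ _ → ⊤ {ℓ}) (⊤⁺ , tt)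
    ... | β , _ , least = β , (λ γ γ<β → least γ γ<β tt) ,
      strictMono⇒≅ _ _ (λ x → x , λ x<β → least _ x<β tt) id id (λ { (x , _) → x , Ordinal.Eq.refl (length σ) })
      , λ _ → refl

    module Rank (σ : Sequence P) where
      open Ordinal (length σ) using (_<⁺_)
      private module C = Cuts (length σ)

      -- Different cuts can give equal tails, so the rank of the tail at `β` may lie strictly before
      -- `β`.
      ranked : ∀ τ β → τ ≋ σ [ β :] → ∃[ γ ] HasRank σ τ γ × ¬ (β <⁺ γ)
      ranked τ β τ≋ with minimal C.<⁺-wellFounded (λ γ → τ ≋ σ [ γ :]) (β , τ≋)
      ... | γ , e , least = γ , (e , least) , λ β<γ → least β β<γ τ≋

      rank-least : ∀ τ {β γ} → HasRank σ τ β → HasRank σ τ γ → ¬ (β <⁺ γ)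
      rank-least τ (e , _) (_ , least) β<γ = least _ β<γ e

      rank-resp-tail : ∀ τ τ′ β → τ ≋ τ′ → HasRank σ τ β → HasRank σ τ′ β
      rank-resp-tail τ τ′ β τ≋τ′ (e , least) =
        ≋-trans′ τ′ τ (σ [ β :]) (≋-sym′ τ τ′ τ≋τ′) e ,
        λ γ γ<β e′ → least γ γ<β (≋-trans′ τ τ′ (σ [ γ :]) τ≋τ′ e′)

      -- Any two ranks of the same tail are incomparable, so the ranks hidden in `TailBefore` can be
      -- traded for the given ones.
      rank-cancel : ∀ τ ρ {β γ} → HasRank σ τ β → HasRank σ ρ γ →
                    TailBefore σ τ ρ → β <⁺ γ
      rank-cancel τ ρ hτ hρ (β′ , γ′ , hτ′ , hρ′ , β′<γ′) =
        C.≮-<-trans (rank-least τ hτ′ hτ) (C.<-≮-trans β′<γ′ (rank-least ρ hρ hρ′))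

      rank-injective : ∀ τ ρ {β γ} → HasRank σ τ β → HasRank σ ρ γ → β C.≈⁺ γ → τ ≋ ρ
      rank-injective τ ρ {β} {γ} (e , _) (d , _) β≈γ =
        ≋-trans′ τ (σ [ γ :]) ρ (≋-trans′ τ (σ [ β :]) (σ [ γ :]) e (tail-cong σ β≈γ))
          (≋-sym′ ρ (σ [ γ :]) d)

    rank-resp : ∀ (σ σ′ τ : Sequence P) β → (i : σ ≋ σ′) → HasRank σ τ β →
                HasRank σ′ τ (mapCut {σ = σ} {σ′} i β)
    rank-resp σ σ′ τ β i (e , least) =
      ≋-trans′ τ (σ [ β :]) (σ′ [ i′ β :]) e (tail-resp {σ = σ} {σ′} i β) ,
      λ γ γ<iβ e′ → let γ₀ , iγ₀≈γ = mapCut-onto {σ = σ} {σ′} i γ in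
        least γ₀ (mapCut-cancel {σ = σ} {σ′} i (C′.<-respˡ-≈ (C′.≈⁺.sym iγ₀≈γ) γ<iβ))
          (≋-trans′ τ (σ′ [ γ :]) (σ [ γ₀ :]) e′
            (≋-sym′ (σ [ γ₀ :]) (σ′ [ γ :])
              (≋-trans′ (σ [ γ₀ :]) (σ′ [ i′ γ₀ :]) (σ′ [ γ :])
                (tail-resp {σ = σ} {σ′} i γ₀) (tail-cong σ′ iγ₀≈γ))))
      where
      module C′ = Cuts (length σ′)
      i′ = mapCut {σ = σ} {σ′} i

    tailBefore-resp : ∀ σ σ′ τ τ′ ρ ρ′ → σ ≋ σ′ → τ ≋ τ′ → ρ ≋ ρ′ →
                      TailBefore σ τ ρ → TailBefore σ′ τ′ ρ′
    tailBefore-resp σ σ′ τ τ′ ρ ρ′ i j k (β , γ , hβ , hγ , β<γ) =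
      i′ β , i′ γ
      , Rank.rank-resp-tail σ′ τ τ′ (i′ β) j (rank-resp σ σ′ τ β i hβ)
      , Rank.rank-resp-tail σ′ ρ ρ′ (i′ γ) k (rank-resp σ σ′ ρ γ i hγ)
      , mapCut-mono {σ = σ} {σ′} i β<γ
      where i′ = mapCut {σ = σ} {σ′} i

    -- The rank of `σ` in itself is the least cut; comparing `β` with it tells whether `τ` is `σ` or
    -- comes later. This is the centring condition on order frames.
    rank⇒≋⊎before : ∀ (σ τ : Sequence P) {β} → HasRank σ τ β → σ ≋ τ ⊎ TailBefore σ σ τ
    rank⇒≋⊎before σ τ {β} hβ with bottom σ
    ... | ⊥⁺ , least , σ≋ with Cuts.compare (length σ) ⊥⁺ β
    ... | tri< ⊥<β _ _ = inj₂ (⊥⁺ , β , (σ≋ , λ γ γ<⊥ _ → least γ γ<⊥) , hβ , ⊥<β)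
    ... | tri≈ _ ⊥≈β _ = inj₁ (Rank.rank-injective σ σ τ (σ≋ , λ γ γ<⊥ _ → least γ γ<⊥) hβ ⊥≈β)
    ... | tri> _ _ β<⊥ = contradiction β<⊥ (least β)

    -- The field of the order at `σ` consists of the sequences that have a rank in `σ`, and rank
    -- embeds them into the well-ordered cuts of `σ`.
    tailOrder-isOrderFrame : (W : Pred (Sequence P) (lsuc ℓ)) → ∃ W →
                             IsOrderFrame (membersSetoid W) (tailOrder W)
    tailOrder-isOrderFrame W w₀ = record
      { nonEmpty  = w₀
      ; cong      = λ { {σ , _} {σ′ , _} {τ , _} {τ′ , _} {ρ , _} {ρ′ , _} → tailBefore-resp σ σ′ τ τ′ ρ ρ′ }
      ; field′    = λ { (σ , _) (τ , _) → Lift (lsuc ℓ) (∃ (HasRank σ τ)) }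
      ; respects  = λ { (σ , _) {τ , _} {τ′ , _} τ≋τ′ (lift (β , h)) →
                        lift (β , Rank.rank-resp-tail σ τ τ′ β τ≋τ′ h) }
      ; within    = λ { (β , γ , hβ , hγ , _) → lift (β , hβ) , lift (γ , hγ) }
      ; wellOrder = wellOrder
      ; centred   = λ { {σ , _} {τ , _} (_ , _ , hτ , _) → rank⇒≋⊎before σ τ hτ }
      }
      where
      wellOrder : ∀ ((σ , _) : ∃ W) → IsStrictWellOrder
        {A = Σ[ (τ , _) ∈ ∃ W ] Lift (lsuc ℓ) (∃ (HasRank σ τ))}
        (λ x y → proj₁ (proj₁ x) ≋ proj₁ (proj₁ y))
        (λ x y → TailBefore σ (proj₁ (proj₁ x)) (proj₁ (proj₁ y)))
      wellOrder (σ , _) = record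
        { isStrictTotalOrder = record
          { isStrictPartialOrder = record
            { isEquivalence = On.isEquivalence (proj₁ ∘ proj₁)
                (Setoid.isEquivalence (sequenceSetoid P))
            ; irrefl = λ { {(τ , _) , lift (β , hβ)} {(ρ , _) , lift (γ , hγ)} τ≋ρ τ<ρ →
                C.irrefl C.≈⁺.refl (R.rank-cancel ρ ρ hγ hγ
                  (tailBefore-resp σ σ τ ρ ρ ρ (≋-refl {σ = σ}) τ≋ρ (≋-refl {σ = ρ}) τ<ρ)) }
            ; trans = λ { {(τ , _) , lift (β , hβ)} {(ρ , _) , lift (γ , hγ)} {(π , _) , lift (δ , hδ)} τ<ρ ρ<π →
                β , δ , hβ , hδ , C.<⁺-trans (R.rank-cancel τ ρ hβ hγ τ<ρ) (R.rank-cancel ρ π hγ hδ ρ<π) }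
            ; <-resp-≈ =
                (λ { {(τ , _) , _} {(ρ , _) , _} {(ρ′ , _) , _} ρ≋ρ′ →
                     tailBefore-resp σ σ τ τ ρ ρ′ (≋-refl {σ = σ}) (≋-refl {σ = τ}) ρ≋ρ′ })
              , (λ { {(ρ , _) , _} {(τ , _) , _} {(τ′ , _) , _} τ≋τ′ →
                     tailBefore-resp σ σ τ τ′ ρ ρ (≋-refl {σ = σ}) τ≋τ′ (≋-refl {σ = ρ}) })
            }
          ; compare = λ { ((τ , _) , lift (β , hβ)) ((ρ , _) , lift (γ , hγ)) → cmp τ ρ hβ hγ }
          }
        ; wellFounded = Subrelation.wellFounded
            (λ { {(τ , _) , lift (_ , hβ)} {(ρ , _) , lift (_ , hγ)} → R.rank-cancel τ ρ hβ hγ })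
            (On.wellFounded (λ { (_ , lift (β , _)) → β }) C.<⁺-wellFounded)
        }
        where
        module R = Rank σ
        module C = Cuts (length σ)

        cmp : ∀ τ ρ {β γ} → HasRank σ τ β → HasRank σ ρ γ →
              Tri (TailBefore σ τ ρ) (τ ≋ ρ) (TailBefore σ ρ τ)
        cmp τ ρ {β} {γ} hβ hγ with C.compare β γ
        ... | tri< β<γ ≉ γ≮β = tri< (β , γ , hβ , hγ , β<γ)
          (λ τ≋ρ → R.rank-least ρ (R.rank-resp-tail τ ρ β τ≋ρ hβ) hγ β<γ)
          (λ ρ<τ → γ≮β (R.rank-cancel ρ τ hγ hβ ρ<τ))
        ... | tri≈ β≮γ β≈γ γ≮β = tri≈ (λ τ<ρ → β≮γ (R.rank-cancel τ ρ hβ hγ τ<ρ))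
          (R.rank-injective τ ρ hβ hγ β≈γ)
          (λ ρ<τ → γ≮β (R.rank-cancel ρ τ hγ hβ ρ<τ))
        ... | tri> β≮γ ≉ γ<β = tri> (λ τ<ρ → β≮γ (R.rank-cancel τ ρ hβ hγ τ<ρ))
          (λ τ≋ρ → R.rank-least τ (R.rank-resp-tail ρ τ γ (≋-sym′ τ ρ τ≋ρ) hγ) hβ γ<β)
          (γ , β , hγ , hβ , γ<β)

    module _ (σ : Sequence P) where

      open Ordinal (length σ) using (Cut; _<⁺_)

      First : Pred (Sequence P) a → Pred Cut (a ⊔ ℓ)
      First A β = A (σ [ β :]) × (∀ γ → γ <⁺ β → ¬ A (σ [ γ :]))

      first : (A : Pred (Sequence P) a) → ∃[ β ] A (σ [ β :]) → ∃ (First A)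
      first A = minimal (Cuts.<⁺-wellFounded (length σ)) (λ β → A (σ [ β :]))

      first-unique : (A : Pred (Sequence P) a) → ∀ {β γ} → First A β → First A γ →
                     Cuts._≈⁺_ (length σ) β γ
      first-unique A {β} {γ} (Aβ , β-least) (Aγ , γ-least) with Cuts.compare (length σ) β γ
      ... | tri< β<γ _ _ = contradiction Aβ (γ-least β β<γ)
      ... | tri≈ _ β≈γ _ = β≈γ
      ... | tri> _ _ γ<β = contradiction Aγ (β-least γ γ<β)

  -- Truth in ordinal sequence models, and soundness

  module Truth (M : OrdinalSequenceModel ℓ) where

    open OrdinalSequenceModel M
    open OrderModel orderModel using (World; R; ⟦_⟧)
    open IsOrderFrame isOrderFrame using () renaming (cong to tailBefore-cong)

    R-resp : ∀ (w w′ y : World) → proj₁ w ≋ proj₁ w′ → R w y → R w′ y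
    R-resp w w′ y w≋w′ (inj₁ w≋y) =
      inj₁ (≋-trans′ (proj₁ w′) (proj₁ w) (proj₁ y) (≋-sym′ (proj₁ w) (proj₁ w′) w≋w′) w≋y)
    R-resp w w′ y w≋w′ (inj₂ w<y) =
      inj₂ (tailBefore-cong {w} {w′} {w} {w′} {y} {y} w≋w′ w≋w′ (≋-refl {σ = proj₁ y}) w<y)

    ⟦⟧-resp : ∀ p (w w′ : World) → proj₁ w ≋ proj₁ w′ → ⟦ p ⟧ w → ⟦ p ⟧ w′
    ⟦⟧-resp (atom k) w w′ w≋w′ (lift Vw) = lift (trans (sym (V-cong k {w} {w′} w≋w′)) Vw)
    ⟦⟧-resp (∼ p) w w′ w≋w′ ¬p = ¬p ∘ ⟦⟧-resp p w′ w (≋-sym′ (proj₁ w) (proj₁ w′) w≋w′)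
    ⟦⟧-resp (p ∧ q) w w′ w≋w′ (pw , qw) = ⟦⟧-resp p w w′ w≋w′ pw , ⟦⟧-resp q w w′ w≋w′ qw
    ⟦⟧-resp (p > q) w w′ w≋w′ (inj₁ none) = inj₁ λ y (Ry , py) →
      none y (R-resp w′ w y (≋-sym′ (proj₁ w) (proj₁ w′) w≋w′) Ry , py)
    ⟦⟧-resp (p > q) w w′ w≋w′ (inj₂ (y , (Ry , py , qy) , least)) =
      inj₂ (y , (R-resp w w′ y w≋w′ Ry , py , qy) , λ x x<y →
        least x (tailBefore-cong {w′} {w} {x} {x} {y} {y} (≋-sym′ (proj₁ w) (proj₁ w′) w≋w′)
          (≋-refl {σ = proj₁ x}) (≋-refl {σ = proj₁ y}) x<y))

    -- `W` need not be closed under tails, so truth at a tail has to include membership in `W`.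
    ⟪_⟫ : Formula → Pred (Sequence P) (lsuc ℓ)
    ⟪ p ⟫ σ = Σ[ w ∈ W σ ] ⟦ p ⟧ (σ , w)

    ⟪⟫-resp : ∀ p (σ τ : Sequence P) → σ ≋ τ → ⟪ p ⟫ σ → ⟪ p ⟫ τ
    ⟪⟫-resp p σ τ σ≋τ (w , pσ) =
      W-respects σ≋τ w , ⟦⟧-resp p (σ , w) (τ , W-respects σ≋τ w) σ≋τ pσ

    -- Together with `rank⇒R` this identifies `R σ` with the tails of `σ` that lie in `W`.
    R⇒rank : ∀ (σ τ : World) → R σ τ → ∃ (HasRank (proj₁ σ) (proj₁ τ))
    R⇒rank (σ , _) (τ , _) (inj₁ σ≋τ) with bottom σ
    ... | ⊥⁺ , _ , σ≋ with Rank.ranked σ τ ⊥⁺ (≋-trans′ τ σ (σ [ ⊥⁺ :]) (≋-sym′ σ τ σ≋τ) σ≋)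
    ... | γ , h , _ = γ , h
    R⇒rank _ _ (inj₂ (_ , γ , _ , h , _)) = γ , h

    rank⇒R : ∀ (σ τ : World) {β} → HasRank (proj₁ σ) (proj₁ τ) β → R σ τ
    rank⇒R (σ , _) (τ , _) = rank⇒≋⊎before σ τ

    -- With `>-elim`, this replaces the clause for `>` by one about cuts: only the first tail in `W`
    -- at which `p` holds matters.
    >-intro : ∀ p q (σ : World) →
              (∀ β → First (proj₁ σ) ⟪ p ⟫ β → ⟪ q ⟫ (proj₁ σ [ β :])) → ⟦ p > q ⟧ σ
    >-intro p q (σ , σ∈W) h with em {P = ∃[ β ] ⟪ p ⟫ (σ [ β :])}
    ... | no none = inj₁ λ { (τ , τ∈W) (Rτ , pτ) → let γ , e , _ = R⇒rank (σ , σ∈W) (τ , τ∈W) Rτ in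
                      none (γ , ⟪⟫-resp p τ (σ [ γ :]) e (τ∈W , pτ)) }
    ... | yes some with first σ ⟪ p ⟫ some
    ... | β , (w , pβ) , least = inj₂ (τ ,
        (rank⇒R (σ , σ∈W) τ rank , pβ , ⟦⟧-resp q (σ [ β :] , proj₁ (h β ((w , pβ) , least))) τ (≋-refl {σ = σ [ β :]})
                                          (proj₂ (h β ((w , pβ) , least))))
        , λ { (ρ , ρ∈W) (γ , β′ , hγ , hβ′ , γ<β′) pρ →
              least γ (Cuts.<-≮-trans (length σ) γ<β′ (Rank.rank-least σ (σ [ β :]) rank hβ′))
                (⟪⟫-resp p ρ (σ [ γ :]) (proj₁ hγ) (ρ∈W , pρ)) })
      where
      τ : World
      τ = σ [ β :] , w
      -- An equal tail at an earlier cut would satisfy `p` too, so the first cut with a `p`-tail is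
      -- the rank of that tail.
      rank : HasRank σ (σ [ β :]) β
      rank = ≋-refl {σ = σ [ β :]} , λ γ γ<β e → least γ γ<β (⟪⟫-resp p (σ [ β :]) (σ [ γ :]) e (w , pβ))

    >-elim : ∀ p q (σ : World) → ⟦ p > q ⟧ σ →
             ∀ β → First (proj₁ σ) ⟪ p ⟫ β → ⟪ q ⟫ (proj₁ σ [ β :])
    >-elim p q (σ , σ∈W) (inj₁ none) β ((w , pβ) , least) =
      contradiction (rank⇒R (σ , σ∈W) (σ [ β :] , w)
        (≋-refl {σ = σ [ β :]} , λ γ γ<β e → least γ γ<β (⟪⟫-resp p (σ [ β :]) (σ [ γ :]) e (w , pβ)))
        , pβ) (none (σ [ β :] , w))
    >-elim p q (σ , σ∈W) (inj₂ ((τ , τ∈W) , (Rτ , pτ , qτ) , least)) β fβ@(_ , β-least)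
      with R⇒rank (σ , σ∈W) (τ , τ∈W) Rτ
    ... | γ , hγ@(e , γ-least) =
      ⟪⟫-resp q τ (σ [ β :])
        (≋-trans′ τ (σ [ γ :]) (σ [ β :]) e (tail-cong σ (first-unique σ ⟪ p ⟫ fγ fβ))) (τ∈W , qτ)
      where
      -- A `p`-tail at a cut `δ` before `γ` has a rank not after `δ`, so it would precede `τ`,
      -- against `least`.
      fγ : First σ ⟪ p ⟫ γ
      fγ = ⟪⟫-resp p τ (σ [ γ :]) e (τ∈W , pτ) , λ δ δ<γ (w , pδ) →
        let δ′ , hδ′ , δ≮δ′ = Rank.ranked σ (σ [ δ :]) δ (≋-refl {σ = σ [ δ :]}) in
        least (σ [ δ :] , w) (δ′ , γ , hδ′ , hγ , Cuts.≮-<-trans (length σ) δ≮δ′ δ<γ) pδ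

    stable : ∀ p (w : World) → ¬ ¬ ⟦ p ⟧ w → ⟦ p ⟧ w
    stable p w ¬¬p with em {P = ⟦ p ⟧ w}
    ... | yes pw = pw
    ... | no ¬p = contradiction ¬p ¬¬p

    ⇒-intro : ∀ p q (w : World) → (⟦ p ⟧ w → ⟦ q ⟧ w) → ⟦ p ⇒ q ⟧ w
    ⇒-intro p q w f (pw , ¬q) = ¬q (f pw)

    ⇒-elim : ∀ p q (w : World) → ⟦ p ⇒ q ⟧ w → ⟦ p ⟧ w → ⟦ q ⟧ w
    ⇒-elim p q w f pw = stable q w λ ¬q → f (pw , ¬q)

    Valid : Formula → Set (lsuc ℓ)
    Valid p = ∀ w → ⟦ p ⟧ w

    valuation : World → (ℕ → Formula) → ℕ → Bool
    valuation w s k with em {P = ⟦ s k ⟧ w}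
    ... | yes _ = true
    ... | no _  = false

    substitute-eval : ∀ w s φ →
      (eval (valuation w s) φ ≡ true → ⟦ substitute s φ ⟧ w) ×
      (eval (valuation w s) φ ≡ false → ¬ ⟦ substitute s φ ⟧ w)
    substitute-eval w s (var k) with em {P = ⟦ s k ⟧ w}
    ... | yes pw = (λ _ → pw) , λ ()
    ... | no ¬p = (λ ()) , λ _ → ¬p
    substitute-eval w s (neg φ) with eval (valuation w s) φ | substitute-eval w s φ
    ... | true  | t , _ = (λ ()) , λ _ ¬φ → ¬φ (t refl)
    ... | false | _ , f = (λ _ → f refl) , λ ()
    substitute-eval w s (conj φ ψ)
      with eval (valuation w s) φ | substitute-eval w s φ | eval (valuation w s) ψ | substitute-eval w s ψ
    ... | true  | t , _ | true  | u , _ = (λ _ → t refl , u refl) , λ ()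
    ... | true  | _     | false | _ , g = (λ ()) , λ _ (_ , ψw) → g refl ψw
    ... | false | _ , f | _     | _     = (λ ()) , λ _ (φw , _) → f refl φw

    normality-sound : ∀ p q r s → Valid (p ∧ q ⇒ r) → Valid ((s > p) ∧ (s > q) ⇒ (s > r))
    normality-sound p q r s v w = ⇒-intro ((s > p) ∧ (s > q)) (s > r) w λ (sp , sq) →
      >-intro s r w λ β fβ → let u , pβ = >-elim s p w sp β fβ ; u′ , qβ = >-elim s q w sq β fβ
                                 τ = proj₁ w [ β :] in
        u , ⇒-elim (p ∧ q) r (τ , u) (v (τ , u)) (pβ , ⟦⟧-resp q (τ , u′) (τ , u) (≋-refl {σ = τ}) qβ)

    -- The first `q`-tail satisfies `p` and the first `p`-tail satisfies `q`, so neither can precede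
    -- the other and they coincide.
    reciprocity-sound : ∀ p q r → Valid ((p > q) ∧ (q > p) ∧ (p > r) ⇒ (q > r))
    reciprocity-sound p q r w@(σ , _) = ⇒-intro ((p > q) ∧ (q > p) ∧ (p > r)) (q > r) w λ (pq , qp , pr) →
      >-intro q r w λ β fq@(qβ , q-least) →
        let pβ = >-elim q p w qp β fq
            γ , fp@(pγ , p-least) = first σ ⟪ p ⟫ (β , pβ)
            qγ = >-elim p q w pq γ fp
            fp′ = pβ , λ δ δ<β pδ → p-least δ (Cuts.<-≮-trans (length σ) δ<β λ γ<β → q-least γ γ<β qγ) pδ
        in >-elim p r w pr β fp′

    c2-sound : ∀ {p} → C2 p → Valid p
    c2-sound (PC φ s taut) w = proj₁ (substitute-eval w s φ) (taut _)
    c2-sound (Identity p) w = >-intro p p w λ _ → proj₁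
    c2-sound (Reciprocity p q r) = reciprocity-sound p q r
    -- If `p` holds at `σ`, its first `p`-tail is the one at the least cut, which is `σ` itself.
    c2-sound (MP p q) w@(σ , w∈) = ⇒-intro (p > q) (p ⇒ q) w λ pq → ⇒-intro p q w λ pw →
      let ⊥⁺ , least , σ≋ = bottom σ
          u , q⊥ = >-elim p q w pq ⊥⁺ (⟪⟫-resp p σ (σ [ ⊥⁺ :]) σ≋ (w∈ , pw) , λ γ γ<⊥ _ → least γ γ<⊥)
      in ⟦⟧-resp q (σ [ ⊥⁺ :] , u) w (≋-sym′ σ (σ [ ⊥⁺ :]) σ≋) q⊥
    c2-sound (CEM p q) w@(σ , _) (¬pq , ¬p¬q) = ¬pq (>-intro p q w λ β fβ@((u , _) , _) →
      u , stable q (σ [ β :] , u) λ ¬q → ¬p¬q (>-intro p (∼ q) w λ γ fγ@((u′ , _) , _) →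
        u′ , ¬q ∘ ⟦⟧-resp q (σ [ γ :] , u′) (σ [ β :] , u) (tail-cong σ (first-unique σ ⟪ p ⟫ fγ fβ))))
    c2-sound (Detachment {p} {q} pq pp) w = ⇒-elim p q w (c2-sound pq w) (c2-sound pp w)
    c2-sound (Normality {p} {q} {r} s v) = normality-sound p q r s (c2-sound v)

    -- If q-tails are p-tails, the first q-tail of σ is the first q-tail of the first p-tail of σ.
    module _ (p q r : Formula) (w : World) where
      private σ = proj₁ w

      flatten : ⟦ p > ((p ∧ q) > r) ⟧ w → ⟦ (p ∧ q) > r ⟧ w
      flatten h = >-intro (p ∧ q) r w go
        where
        go : ∀ γ → First σ ⟪ p ∧ q ⟫ γ → ⟪ r ⟫ (σ [ γ :])
        go γ ((u , pγ , qγ) , γ-least) with first σ ⟪ p ⟫ (γ , u , pγ)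
        ... | β , fβ@(pβ , β-least) with >-elim p ((p ∧ q) > r) w h β fβ
        ... | v , hβ with forget-onto σ β γ (λ γ<β → β-least γ γ<β (u , pγ))
        ... | δ , refl = ⟪⟫-resp r ((σ [ β :]) [ δ :]) (σ [ γ :]) (tail-tail σ β δ)
                (>-elim (p ∧ q) r (σ [ β :] , v) hβ δ
                  ( ⟪⟫-resp (p ∧ q) (σ [ γ :]) ((σ [ β :]) [ δ :])
                      (≋-sym′ ((σ [ β :]) [ δ :]) (σ [ γ :]) (tail-tail σ β δ)) (u , pγ , qγ)
                  , λ ε ε<δ x → γ-least (forget σ β ε) (forget-mono σ β ε<δ)
                      (⟪⟫-resp (p ∧ q) ((σ [ β :]) [ ε :]) (σ [ forget σ β ε :]) (tail-tail σ β ε) x)))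

      unflatten : ⟦ (p ∧ q) > r ⟧ w → ⟦ p > ((p ∧ q) > r) ⟧ w
      unflatten h = >-intro p ((p ∧ q) > r) w λ { β ((u , pβ) , β-least) →
        u , >-intro (p ∧ q) r (σ [ β :] , u) λ { δ (pqδ , δ-least) →
          ⟪⟫-resp r (σ [ forget σ β δ :]) ((σ [ β :]) [ δ :])
            (≋-sym′ ((σ [ β :]) [ δ :]) (σ [ forget σ β δ :]) (tail-tail σ β δ))
            (>-elim (p ∧ q) r w h (forget σ β δ)
              ( ⟪⟫-resp (p ∧ q) ((σ [ β :]) [ δ :]) (σ [ forget σ β δ :]) (tail-tail σ β δ) pqδ
              , λ ε ε<δ pqε → minimality β β-least δ δ-least ε ε<δ pqε)) } }
        where
        -- A `p ∧ q`-tail is a `p`-tail, so it cannot begin before `β` and is a tail of `σ [ β :]`.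
        minimality : ∀ β → (∀ γ → Ordinal._<⁺_ (length σ) γ β → ¬ ⟪ p ⟫ (σ [ γ :])) → ∀ δ →
          (∀ γ → Ordinal._<⁺_ (length (σ [ β :])) γ δ → ¬ ⟪ p ∧ q ⟫ ((σ [ β :]) [ γ :])) →
          ∀ ε → Ordinal._<⁺_ (length σ) ε (forget σ β δ) → ¬ ⟪ p ∧ q ⟫ (σ [ ε :])
        minimality β β-least δ δ-least ε ε<δ (x , px , qx)
          with forget-onto σ β ε (λ ε<β → β-least ε ε<β (x , px))
        ... | ε′ , refl = δ-least ε′ (forget-cancel σ β ε<δ)
              (⟪⟫-resp (p ∧ q) (σ [ ε :]) ((σ [ β :]) [ ε′ :])
                (≋-sym′ ((σ [ β :]) [ ε′ :]) (σ [ ε :]) (tail-tail σ β ε′)) (x , px , qx))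

    sound : ∀ {p} → ⊢C2F p → Valid p
    sound (fromC2 x) = c2-sound x
    sound (Flattening p q r) w =
      ⇒-intro (p > ((p ∧ q) > r)) ((p ∧ q) > r) w (flatten p q r w) ,
      ⇒-intro ((p ∧ q) > r) (p > ((p ∧ q) > r)) w (unflatten p q r w)
    sound (Detachment {p} {q} pq pp) w = ⇒-elim p q w (sound pq w) (sound pp w)
    sound (Normality {p} {q} {r} s v) = normality-sound p q r s (sound v)

-- Derivations

infixr 20 _⟶_

_⟶_ : PropFormula → PropFormula → PropFormula
φ ⟶ ψ = neg (conj φ (neg ψ))

x₀ x₁ x₂ x₃ : PropFormula
x₀ = var 0
x₁ = var 1
x₂ = var 2
x₃ = var 3

tuple : ∀ {a} {A : Set a} → A → A → A → A → ℕ → A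
tuple a b c d 0 = a
tuple a b c d 1 = b
tuple a b c d 2 = c
tuple a b c d _ = d

both : (Bool → Bool) → Bool
both f = f true ∧ᵇ f false

both-at : ∀ f b → T (both f) → T (f b)
both-at f true  h = proj₁ (Equivalence.to T-∧ h)
both-at f false h = proj₂ (Equivalence.to T-∧ h)

valid : PropFormula → Bool
valid φ = both λ a → both λ b → both λ c → both λ d → eval (tuple a b c d) φ

fourVars : PropFormula → Bool
fourVars (var 0) = true
fourVars (var 1) = true
fourVars (var 2) = true
fourVars (var 3) = true
fourVars (var _) = false
fourVars (neg φ) = fourVars φ
fourVars (conj φ ψ) = fourVars φ ∧ᵇ fourVars ψ

eval-tuple : ∀ v φ → T (fourVars φ) → eval v φ ≡ eval (tuple (v 0) (v 1) (v 2) (v 3)) φ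
eval-tuple v (var 0) _ = refl
eval-tuple v (var 1) _ = refl
eval-tuple v (var 2) _ = refl
eval-tuple v (var 3) _ = refl
eval-tuple v (neg φ) h = cong not (eval-tuple v φ h)
eval-tuple v (conj φ ψ) h = let hφ , hψ = Equivalence.to T-∧ h in
  cong₂ _∧ᵇ_ (eval-tuple v φ hφ) (eval-tuple v ψ hψ)

tautology : ∀ φ → T (fourVars φ) → T (valid φ) → Tautology φ
tautology φ h t v = trans (eval-tuple v φ h)
  (Equivalence.to T-≡
    (both-at (λ d → eval (tuple (v 0) (v 1) (v 2) d) φ) (v 3)
      (both-at (λ c → both λ d → eval (tuple (v 0) (v 1) c d) φ) (v 2)
        (both-at (λ b → both λ c → both λ d → eval (tuple (v 0) b c d) φ) (v 1)
          (both-at (λ a → both λ b → both λ c → both λ d → eval (tuple a b c d) φ) (v 0) t)))))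

-- For a concrete schema the two implicit arguments are filled by evaluating a truth table with
-- sixteen rows. Formulas passed for variables that do not occur in `φ` are arbitrary.
taut : ∀ φ {_ : T (fourVars φ)} {_ : T (valid φ)} a b c d → ⊢C2F substitute (tuple a b c d) φ
taut φ {h} {t} a b c d = fromC2 (PC φ (tuple a b c d) (tautology φ h t))

-- Closure under modus ponens, but not under Normality, is demanded, so that the consequences `d ⊩_`
-- of a formula and the consequents of a fixed antecedent are instances as well as the theorems.
record Theory (Γ : Pred Formula 0ℓ) : Set where
  field
    thm : ∀ {p} → ⊢C2F p → Γ p
    mp  : ∀ {p q} → Γ (p ⇒ q) → Γ p → Γ q

  mp₂ : ∀ {p q r} → Γ (p ⇒ q ⇒ r) → Γ p → Γ q → Γ r
  mp₂ f x y = mp (mp f x) y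

  ∧-intro : ∀ {p q} → Γ p → Γ q → Γ (p ∧ q)
  ∧-intro {p} {q} = mp₂ (thm (taut (x₀ ⟶ x₁ ⟶ conj x₀ x₁) p q q q))

  ⇔-to : ∀ {p q} → ⊢C2F (p ⇔ q) → Γ p → Γ q
  ⇔-to {p} {q} e = mp (mp (thm (taut (conj (x₀ ⟶ x₁) (x₁ ⟶ x₀) ⟶ x₀ ⟶ x₁) p q q q)) (thm e))

  ⇔-from : ∀ {p q} → ⊢C2F (p ⇔ q) → Γ q → Γ p
  ⇔-from {p} {q} e = mp (mp (thm (taut (conj (x₀ ⟶ x₁) (x₁ ⟶ x₀) ⟶ x₁ ⟶ x₀) p q q q)) (thm e))

theorems : Theory ⊢C2F_
theorems = record { thm = λ x → x ; mp = Detachment }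

_⊩_ : Formula → Pred Formula 0ℓ
d ⊩ p = ⊢C2F (d ⇒ p)

given : ∀ d → Theory (d ⊩_)
given d = record
  { thm = λ {p} → Detachment (taut (x₀ ⟶ x₁ ⟶ x₀) p d d d)
  ; mp  = λ {p} {q} f x → Theory.mp₂ theorems
      (taut ((x₀ ⟶ x₁ ⟶ x₂) ⟶ (x₀ ⟶ x₁) ⟶ x₀ ⟶ x₂) d p q q) f x
  }

⊩-refl : ∀ d → d ⊩ d
⊩-refl d = taut (x₀ ⟶ x₀) d d d d

contrapose : ∀ {p q} → p ⊩ (∼ q) → q ⊩ (∼ p)
contrapose {p} {q} = Detachment (taut ((x₀ ⟶ neg x₁) ⟶ x₁ ⟶ neg x₀) p q q q)

-- Normality takes two conditionals with antecedent `s`; Identity supplies `s > s` for both.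
necessitation : ∀ {s p} → ⊢C2F p → ⊢C2F (s > p)
necessitation {s} {p} ⊢p = Detachment
  (Normality s (Detachment (taut (x₀ ⟶ conj x₁ x₁ ⟶ x₀) p s s s) ⊢p))
  (Theory.∧-intro theorems (fromC2 (Identity s)) (fromC2 (Identity s)))

module Consequents {Γ : Pred Formula 0ℓ} (th : Theory Γ) where
  open Theory th

  >-mono : ∀ {s p q} → p ⊩ q → Γ (s > p) → Γ (s > q)
  >-mono {s} {p} {q} p⊩q x = mp
    (thm (Normality s (Detachment (taut ((x₀ ⟶ x₁) ⟶ conj x₀ x₀ ⟶ x₁) p q q q) p⊩q)))
    (∧-intro x x)

  supposing : ∀ s → Theory (λ p → Γ (s > p))
  supposing s = record
    { thm = λ ⊢p → thm (necessitation ⊢p)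
    ; mp  = λ {p} {q} f x → mp
        (thm (Normality s (taut (conj (x₀ ⟶ x₁) x₀ ⟶ x₁) p q q q))) (∧-intro f x)
    }

  reciprocity : ∀ {p q r} → Γ (p > q) → Γ (q > p) → Γ (p > r) → Γ (q > r)
  reciprocity {p} {q} {r} x y z =
    mp (thm (fromC2 (Reciprocity p q r))) (∧-intro x (∧-intro y z))

  -- Weakening the consequents of `p > p` and `q > q` gives the two converse conditionals that
  -- Reciprocity asks for.
  >-antecedent : ∀ {p q r} → p ⊩ q → q ⊩ p → Γ (p > r) → Γ (q > r)
  >-antecedent {p} {q} p⊩q q⊩p = reciprocity
    (>-mono p⊩q (thm (fromC2 (Identity p)))) (>-mono q⊩p (thm (fromC2 (Identity q))))

  >-modusPonens : ∀ {p q} → Γ (p > q) → Γ p → Γ q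
  >-modusPonens {p} {q} = mp₂ (thm (fromC2 (MP p q)))

  -- Otherwise CEM gives `p > ∼ q`, and MP turns this into `∼ q`.
  >-centering : ∀ {p q} → Γ p → Γ q → Γ (p > q)
  >-centering {p} {q} x y = mp₂
    (mp₂ (thm (taut (neg (conj (neg x₀) (neg x₁)) ⟶ (x₁ ⟶ x₂ ⟶ neg x₃) ⟶ x₂ ⟶ x₃ ⟶ x₀)
                    (p > q) (p > ∼ q) p q))
      (thm (fromC2 (CEM p q))) (thm (fromC2 (MP p (∼ q))))) x y

  >-CEM : ∀ {p q} → Γ (∼ (p > q)) → Γ (p > ∼ q)
  >-CEM {p} {q} = mp (mp (thm (taut (neg (conj (neg x₀) (neg x₁)) ⟶ neg x₀ ⟶ x₁)
                                    (p > q) (p > ∼ q) p p)) (thm (fromC2 (CEM p q))))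

module _ {Γ : Pred Formula 0ℓ} (th : Theory Γ) {p q r : Formula} (p⊩q : p ⊩ q) where
  open Theory th
  open Consequents th

  private
    q∧p⊩p : (q ∧ p) ⊩ p
    q∧p⊩p = taut (conj x₀ x₁ ⟶ x₁) q p p p

    p⊩q∧p : p ⊩ (q ∧ p)
    p⊩q∧p = Theory.∧-intro (given p) p⊩q (⊩-refl p)

  -- As `p` entails `q`, it is equivalent to `q ∧ p`; this and `>-unflatten` are the two halves of
  -- Flattening with that antecedent simplified.
  >-flatten : Γ (q > (p > r)) → Γ (p > r)
  >-flatten x = >-antecedent q∧p⊩p p⊩q∧p (⇔-to (Flattening q p r)
    (>-mono (Consequents.>-antecedent (given (p > r)) p⊩q∧p q∧p⊩p (⊩-refl (p > r))) x))

  >-unflatten : Γ (p > r) → Γ (q > (p > r))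
  >-unflatten x =
    >-mono (Consequents.>-antecedent (given ((q ∧ p) > r)) q∧p⊩p p⊩q∧p (⊩-refl ((q ∧ p) > r)))
      (⇔-from (Flattening q p r) (>-antecedent p⊩q∧p q∧p⊩p x))

-- States

⊥ᶠ : Formula
⊥ᶠ = atom 0 ∧ ∼ atom 0

⊥ᶠ-elim : ∀ {p} → ⊥ᶠ ⊩ p
⊥ᶠ-elim {p} = taut (conj x₀ (neg x₀) ⟶ x₁) (atom 0) p p p

disjunction : List Formula → Formula
disjunction []      = ⊥ᶠ
disjunction (p ∷ E) = p ∨ disjunction E

disjunction-intro : ∀ {p E} → p ∈ˡ E → p ⊩ disjunction E
disjunction-intro {p} {_ ∷ E} (here refl) =
  taut (x₀ ⟶ neg (conj (neg x₀) (neg x₁))) p (disjunction E) p p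
disjunction-intro {p} {q ∷ E} (there p∈E) = Theory.mp (given p)
  (Theory.thm (given p) (taut (x₀ ⟶ neg (conj (neg x₁) (neg x₀))) (disjunction E) q p p))
  (disjunction-intro p∈E)

-- One conjunct or its negation is chosen for each formula of the list; `∼ ⊥ᶠ` serves as the empty
-- conjunction.
states : List Formula → List Formula
states []      = ∼ ⊥ᶠ ∷ []
states (p ∷ Φ) = map (p ∧_) (states Φ) ++ map (∼ p ∧_) (states Φ)

decides : ∀ Φ {d p} → d ∈ˡ states Φ → p ∈ˡ Φ → d ⊩ p ⊎ d ⊩ (∼ p)
decides (q ∷ Φ) {p = p} d∈ p∈ with ∈-++⁻ (map (q ∧_) (states Φ)) d∈
decides (q ∷ Φ) d∈ p∈ | inj₁ d∈ˡ with ∈-map⁻ (q ∧_) d∈ˡ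
decides (q ∷ Φ) d∈ (here refl) | inj₁ d∈ˡ | e , e∈ , refl = inj₁ (taut (conj x₀ x₁ ⟶ x₀) q e e e)
decides (q ∷ Φ) {p = p} d∈ (there p∈) | inj₁ d∈ˡ | e , e∈ , refl with decides Φ e∈ p∈
... | inj₁ e⊩p  = inj₁ (Detachment (taut ((x₁ ⟶ x₂) ⟶ conj x₀ x₁ ⟶ x₂) q e p p) e⊩p)
... | inj₂ e⊩¬p = inj₂ (Detachment (taut ((x₁ ⟶ neg x₂) ⟶ conj x₀ x₁ ⟶ neg x₂) q e p p) e⊩¬p)
decides (q ∷ Φ) d∈ p∈ | inj₂ d∈ʳ with ∈-map⁻ (∼ q ∧_) d∈ʳ
decides (q ∷ Φ) d∈ (here refl) | inj₂ d∈ʳ | e , e∈ , refl = inj₂ (taut (conj (neg x₀) x₁ ⟶ neg x₀) q e e e)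
decides (q ∷ Φ) {p = p} d∈ (there p∈) | inj₂ d∈ʳ | e , e∈ , refl with decides Φ e∈ p∈
... | inj₁ e⊩p  = inj₁ (Detachment (taut ((x₁ ⟶ x₂) ⟶ conj (neg x₀) x₁ ⟶ x₂) q e p p) e⊩p)
... | inj₂ e⊩¬p = inj₂ (Detachment (taut ((x₁ ⟶ neg x₂) ⟶ conj (neg x₀) x₁ ⟶ neg x₂) q e p p) e⊩¬p)

Agree : Formula → Formula → Formula → Set
Agree d e p = (d ⊩ p → e ⊩ p) × (e ⊩ p → d ⊩ p)

agree-refl : ∀ {d p} → Agree d d p
agree-refl = (λ x → x) , λ x → x

agree-sym : ∀ {d e p} → Agree d e p → Agree e d p
agree-sym (f , g) = g , f

agree-trans : ∀ {d e f p} → Agree d e p → Agree e f p → Agree d f p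
agree-trans (i , j) (k , l) = (λ x → k (i x)) , λ x → j (l x)

record IsState (Φ : List Formula) (d : Formula) : Set where
  field
    isConjunction : d ∈ˡ states Φ
    consistent    : ¬ (⊢C2F (∼ d))

  excludes : ∀ {p} → d ⊩ p → ¬ (d ⊩ (∼ p))
  excludes {p} x y = consistent (Theory.mp₂ theorems
    (taut ((x₀ ⟶ x₁) ⟶ (x₀ ⟶ neg x₁) ⟶ neg x₀) d p p p) x y)

  negates : ∀ {p} → p ∈ˡ Φ → ¬ (d ⊩ p) → d ⊩ (∼ p)
  negates p∈ ¬p with decides Φ isConjunction p∈
  ... | inj₁ x = contradiction x ¬p
  ... | inj₂ y = y

-- States consistent with a theory, and the choice of a next state

module Lindenbaum (em : ∀ {a} → ExcludedMiddle a) where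

  -- Conjuncts are added one at a time: a theory that refutes both `p ∧ d` and `∼ p ∧ d` refutes
  -- `d`.
  lindenbaum : ∀ {Γ} → Theory Γ → ¬ Γ ⊥ᶠ → ∀ Φ → ∃[ d ] d ∈ˡ states Φ × ¬ Γ (∼ d)
  lindenbaum th ¬⊥ [] = ∼ ⊥ᶠ , here refl , λ x →
    ¬⊥ (Theory.mp th (Theory.thm th (taut (neg (neg x₀) ⟶ x₀) ⊥ᶠ ⊥ᶠ ⊥ᶠ ⊥ᶠ)) x)
  lindenbaum {Γ} th ¬⊥ (p ∷ Φ) with lindenbaum th ¬⊥ Φ
  ... | d , d∈ , ¬d with em {P = Γ (∼ (p ∧ d))}
  ... | no ¬pd = p ∧ d , ∈-++⁺ˡ (∈-map⁺ (p ∧_) d∈) , ¬pd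
  ... | yes pd = ∼ p ∧ d , ∈-++⁺ʳ (map (p ∧_) (states Φ)) (∈-map⁺ (∼ p ∧_) d∈) , λ ¬pd →
    ¬d (Theory.mp₂ th (Theory.thm th
      (taut (neg (conj x₀ x₁) ⟶ neg (conj (neg x₀) x₁) ⟶ neg x₁) p d d d)) pd ¬pd)

  -- y is a state at the nearest E-world, as seen from d; if d excludes all
  -- E-worlds then y is d.
  jump : ∀ Φ {d} → IsState Φ d → ∀ E → (∀ {p} → p ∈ˡ E → p ∈ˡ Φ) →
         ∃[ y ] IsState Φ y
              × (∀ {p q} → p ∈ˡ E → (p > q) ∈ˡ Φ → Agree d y (p > q))
              × ((∀ {p q} → p ∈ˡ E → d ⊩ (p > q)) ⊎ ∃[ p ] p ∈ˡ E × y ⊩ p)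
  jump Φ {d} d-state E E⊆Φ with em {P = d ⊩ (disjunction E > ⊥ᶠ)}
  -- From `disjunction E > ⊥ᶠ` follow `disjunction E > p` and `disjunction E > q`, while
  -- `p > disjunction E` is provable; Reciprocity gives `p > q`.
  ... | yes inconsistent = d , d-state , (λ _ _ → agree-refl) , inj₁ λ p∈E →
    reciprocity (>-mono ⊥ᶠ-elim inconsistent)
      (Theory.thm (given d) (Consequents.>-mono theorems (disjunction-intro p∈E) (fromC2 (Identity _))))
      (>-mono ⊥ᶠ-elim inconsistent)
    where open Consequents (given d)
  ... | no ¬inconsistent with lindenbaum (Consequents.supposing (given d) (disjunction E)) ¬inconsistent Φ
  ... | y , y∈ , ¬∼y = y , y-state , agree , inj₂ (progress E E⊆Φ ∼D)
    where
    open Consequents (given d)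

    y-state : IsState Φ y
    y-state = record
      { isConjunction = y∈
      ; consistent    = λ ⊢∼y → ¬∼y (Theory.thm (given d) (necessitation ⊢∼y))
      }

    -- If `y` refuted `disjunction E`, Identity would give `disjunction E > ∼ y` at `d`, contrary to
    -- the choice of `y`.
    ∼D : ¬ (y ⊩ (∼ disjunction E))
    ∼D x = ¬∼y (>-mono (contrapose x) (Theory.thm (given d) (fromC2 (Identity _))))

    progress : ∀ E → (∀ {p} → p ∈ˡ E → p ∈ˡ Φ) → ¬ (y ⊩ (∼ disjunction E)) → ∃[ p ] p ∈ˡ E × y ⊩ p
    progress [] _ h = contradiction (contrapose ⊥ᶠ-elim) h
    progress (p ∷ E) E⊆Φ h with decides Φ y∈ (E⊆Φ (here refl))
    ... | inj₁ y⊩p  = p , here refl , y⊩p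
    ... | inj₂ y⊩∼p with progress E (λ q∈ → E⊆Φ (there q∈)) (λ y⊩∼D → h (Theory.mp₂ (given y)
            (Theory.thm (given y) (taut (neg x₀ ⟶ neg x₁ ⟶ neg (neg (conj (neg x₀) (neg x₁)))) p (disjunction E) p p))
            y⊩∼p y⊩∼D))
    ... | q , q∈ , y⊩q = q , there q∈ , y⊩q

    agree : ∀ {p q} → p ∈ˡ E → (p > q) ∈ˡ Φ → Agree d y (p > q)
    agree {p} {q} p∈E pq∈Φ = to , from
      where
      -- If `y` refuted `p > q`, then `disjunction E > (p > q)`, obtained by `>-unflatten`, would
      -- yield `disjunction E > ∼ y` at `d`.
      to : d ⊩ (p > q) → y ⊩ (p > q)
      to x with decides Φ y∈ pq∈Φ
      ... | inj₁ y⊩ = y⊩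
      ... | inj₂ y⊩∼ = contradiction
        (>-mono (contrapose y⊩∼) (>-unflatten (given d) (disjunction-intro p∈E) x)) ¬∼y

      -- If `d` refuted `p > q`, it would refute `disjunction E > (p > q)` by `>-flatten`; CEM then
      -- gives `disjunction E > ∼ (p > q)`, which again excludes `y`.
      from : y ⊩ (p > q) → d ⊩ (p > q)
      from x with decides Φ (IsState.isConjunction d-state) pq∈Φ
      ... | inj₁ d⊩ = d⊩
      ... | inj₂ d⊩∼ = contradiction
        (>-mono (contrapose (Theory.mp (given y) (Theory.thm (given y) (taut (x₀ ⟶ neg (neg x₀)) (p > q) p p p)) x))
          (>-CEM (Theory.mp₂ (given d) (Theory.thm (given d)
            (taut ((x₀ ⟶ x₁) ⟶ neg x₁ ⟶ neg x₀) (disjunction E > (p > q)) (p > q) p p))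
            (Theory.thm (given d) (>-flatten (given _) (disjunction-intro p∈E) (⊩-refl _))) d⊩∼)))
        ¬∼y

-- Powers of ω

-- Cantor normal form with the highest coefficient first, so that `a ∷ x` is position `x` of block
-- number `a`.
ω^_ : ℕ → Ordinal 0ℓ
ω^ k = record
  { Carrier           = Vec ℕ k
  ; _≈_               = Pointwise _≡_
  ; _<_               = Lex-< _≡_ ℕ._<_
  ; isStrictWellOrder = record
    { isStrictTotalOrder = <-isStrictTotalOrder ℕ.<-isStrictTotalOrder
    ; wellFounded        = <-wellFounded trans (proj₁ (resp₂ ℕ._<_)) ℕ.<-wellFounded
    }
  }

infix 4 _≺_

_≺_ : Vec ℕ k → Vec ℕ k → Set
_≺_ {k} = Ordinal._<_ (ω^ k)

≺-compare : (x y : Vec ℕ k) → Tri (x ≺ y) (x ≡ y) (y ≺ x)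
≺-compare {k} x y with Ordinal.compare (ω^ k) x y
... | tri< x≺y x≉y y⊀x = tri< x≺y (x≉y ∘ ≡⇒Pointwise-≡) y⊀x
... | tri≈ x⊀y x≈y y⊀x = tri≈ x⊀y (Pointwise-≡⇒≡ x≈y) y⊀x
... | tri> x⊀y x≉y y≺x = tri> x⊀y (x≉y ∘ ≡⇒Pointwise-≡) y≺x

≺-irrefl : {x : Vec ℕ k} → ¬ (x ≺ x)
≺-irrefl {k} = Ordinal.irrefl (ω^ k) (≡⇒Pointwise-≡ refl)

≺-trans : {x y z : Vec ℕ k} → x ≺ y → y ≺ z → x ≺ z
≺-trans {k} = Ordinal.trans (ω^ k)

⊀-trans : {x y z : Vec ℕ k} → ¬ (y ≺ x) → ¬ (z ≺ y) → ¬ (z ≺ x)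
⊀-trans {x = x} {y} {z} y⊀x z⊀y z≺x with ≺-compare x y
... | tri< x≺y _ _ = z⊀y (≺-trans z≺x x≺y)
... | tri≈ _ refl _ = z⊀y z≺x
... | tri> _ _ y≺x = y⊀x y≺x

tail-⊀ : ∀ {a} {x y : Vec ℕ k} → ¬ (y ≺ x) → ¬ ((a ∷ y) ≺ (a ∷ x))
tail-⊀ y⊀x (this a<a _) = ℕ.<-irrefl refl a<a
tail-⊀ y⊀x (next _ y≺x) = y⊀x y≺x

origin : Vec ℕ k
origin = replicate _ 0

⊀-origin : (x : Vec ℕ k) → ¬ (x ≺ origin)
⊀-origin [] = xs≮[]
⊀-origin (_ ∷ x) (next _ x≺) = ⊀-origin x x≺

-- Ordinal addition: a leading digit that is not 0 absorbs the lower digits of x.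
_⊕_ : Vec ℕ k → Vec ℕ k → Vec ℕ k
[]      ⊕ []          = []
(a ∷ x) ⊕ (zero ∷ y)  = a ∷ (x ⊕ y)
(a ∷ x) ⊕ (suc b ∷ y) = (suc b + a) ∷ y

⊕-mono : ∀ (x : Vec ℕ k) {y z} → y ≺ z → (x ⊕ y) ≺ (x ⊕ z)
⊕-mono [] {[]} {[]} y≺z = contradiction y≺z xs≮[]
⊕-mono (a ∷ x) {zero ∷ y}  {zero ∷ z}  (next _ y≺z)   = next refl (⊕-mono x y≺z)
⊕-mono (a ∷ x) {zero ∷ y}  {suc c ∷ z} (this _ _)     = this (s≤s (ℕ.m≤n+m a c)) refl
⊕-mono (a ∷ x) {suc b ∷ y} {suc c ∷ z} (this b<c _)   = this (ℕ.+-monoˡ-< a b<c) refl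
⊕-mono (a ∷ x) {suc b ∷ y} {suc b ∷ z} (next refl y≺z) = next refl y≺z

⊕-⊀ : ∀ (x y : Vec ℕ k) → ¬ ((x ⊕ y) ≺ x)
⊕-⊀ [] [] = xs≮[]
⊕-⊀ (a ∷ x) (zero ∷ y)  = tail-⊀ (⊕-⊀ x y)
⊕-⊀ (a ∷ x) (suc b ∷ y) (this lt _) = ℕ.<-irrefl refl (ℕ.<-≤-trans lt (ℕ.m≤n+m a (suc b)))
⊕-⊀ (a ∷ x) (suc b ∷ y) (next eq _) = ℕ.m≢1+n+m a (sym eq)

⊕-onto : ∀ (x y : Vec ℕ k) → ¬ (y ≺ x) → ∃[ z ] x ⊕ z ≡ y
⊕-onto [] [] _ = [] , refl
⊕-onto (a ∷ x) (b ∷ y) y⊀x with ℕ.<-cmp a b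
... | tri> _ _ b<a  = contradiction (this b<a refl) y⊀x
... | tri≈ _ refl _ = let z , eq = ⊕-onto x y (y⊀x ∘ next refl) in 0 ∷ z , cong (a ∷_) eq
... | tri< a<b _ _  = let c , eq = ℕ.m≤n⇒∃[o]m+o≡n a<b in
  suc c ∷ y , cong (_∷ y) (trans (cong suc (ℕ.+-comm c a)) eq)

-- Canonical sequences

remove : ∀ {a} {A : Set a} {x : A} {xs} → x ∈ˡ xs →
         ∃[ ys ] ∣ xs ∣ ≡ suc ∣ ys ∣ × (∀ {y} → y ∈ˡ xs → y ≢ x → y ∈ˡ ys)
remove {xs = _ ∷ xs} (here refl) = xs , refl , λ where
  (here refl) y≢x → contradiction refl y≢x
  (there y∈)  _   → y∈
remove {xs = x ∷ xs} (there x∈) with remove x∈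
... | ys , eq , keep = x ∷ ys , cong suc eq , λ where
  (here refl) _   → here refl
  (there y∈)  y≢x → there (keep y∈ y≢x)

module Construction (em : ∀ {a} → ExcludedMiddle a) (Φ : List Formula)
                    (antecedent : ∀ {p q} → (p > q) ∈ˡ Φ → p ∈ˡ Φ) where

  open Lindenbaum em

  FalseOn : (Vec ℕ k → Formula) → Formula → Vec ℕ k → Vec ℕ k → Set
  FalseOn t p x y = ∀ z → ¬ (z ≺ x) → z ≺ y → ¬ (t z ⊩ p)

  FalseFrom : (Vec ℕ k → Formula) → Formula → Vec ℕ k → Set
  FalseFrom t p x = ∀ z → ¬ (z ≺ x) → ¬ (t z ⊩ p)

  -- When no entry from `x` on and before `y` satisfies `p`, the same first `p`-tail decides `p > q`
  -- at `x` and at `y`.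
  Coherent : (Vec ℕ k → Formula) → Set
  Coherent t = ∀ {x y} → x ≺ y → ∀ {p q} → (p > q) ∈ˡ Φ → FalseOn t p x y → Agree (t x) (t y) (p > q)

  -- The vacuous case of the clause for `>`: where `p` never holds again, each `p > q` is true and
  -- so has to be provable.
  Complete : (Vec ℕ k → Formula) → Set
  Complete t = ∀ x p q → (p > q) ∈ˡ Φ → FalseFrom t p x → t x ⊩ (p > q)

  record Good (t : Vec ℕ k → Formula) : Set where
    field
      isState  : ∀ x → IsState Φ (t x)
      coherent : Coherent t

  -- `coherent` keeps `t` followed by `y` coherent, and `progress` drives the count of formulas in
  -- `complete⊎fewer`.
  record Next (t : Vec ℕ k → Formula) (y : Formula) : Set where
    field
      isState  : IsState Φ y
      coherent : ∀ {x p q} → (p > q) ∈ˡ Φ → FalseFrom t p x → Agree (t x) y (p > q)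
      progress : Complete t ⊎ ∃[ p ] p ∈ˡ Φ × ∃ (FalseFrom t p) × y ⊩ p

  falseFrom-mono : ∀ {t : Vec ℕ k → Formula} {p x y} → ¬ (y ≺ x) → FalseFrom t p x → FalseFrom t p y
  falseFrom-mono y⊀x f z z⊀y = f z (⊀-trans y⊀x z⊀y)

  -- Each eventually false formula of the finite list has its own threshold; the largest of them is
  -- the common `x`.
  eventuallyFalse : (t : Vec ℕ k → Formula) (L : List Formula) → ∃[ E ] ∃[ x ]
    (∀ {p} → p ∈ˡ E → p ∈ˡ L × FalseFrom t p x) × (∀ {p} → p ∈ˡ L → ∃ (FalseFrom t p) → p ∈ˡ E)
  eventuallyFalse t [] = [] , origin , (λ ()) , λ ()
  eventuallyFalse t (p ∷ L) with eventuallyFalse t L | em {P = ∃ (FalseFrom t p)}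
  ... | E , x , fwd , bwd | no ¬p = E , x , (λ q∈ → let q∈L , f = fwd q∈ in there q∈L , f) , λ where
    (here refl) f → contradiction f ¬p
    (there q∈)  f → bwd q∈ f
  ... | E , x , fwd , bwd | yes (y , fp) = p ∷ E , z , (λ where
        (here refl) → here refl , falseFrom-mono {t = t} {p} z⊀y fp
        (there {x = q} q∈)  → let q∈L , f = fwd q∈ in there q∈L , falseFrom-mono {t = t} z⊀x f) , λ where
      (here refl) f → here refl
      (there q∈)  f → there (bwd q∈ f)
    where
    max : ∀ (x y : Vec ℕ _) → ∃[ z ] ¬ (z ≺ x) × ¬ (z ≺ y)
    max x y with ≺-compare x y
    ... | tri< _ _ y⊀x = y , y⊀x , ≺-irrefl
    ... | tri≈ _ refl _ = y , ≺-irrefl , ≺-irrefl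
    ... | tri> x⊀y _ _ = x , ≺-irrefl , x⊀y
    z = proj₁ (max x y)
    z⊀x = proj₁ (proj₂ (max x y))
    z⊀y = proj₂ (proj₂ (max x y))

  coherentFrom : {t : Vec ℕ k → Formula} → Coherent t → ∀ {x y p q} → (p > q) ∈ˡ Φ →
                 FalseFrom t p x → FalseFrom t p y → Agree (t x) (t y) (p > q)
  coherentFrom coh {x} {y} pq∈ fx fy with ≺-compare x y
  ... | tri< x≺y _ _ = coh x≺y pq∈ λ z z⊀x _ → fx z z⊀x
  ... | tri≈ _ refl _ = agree-refl
  ... | tri> _ _ y≺x = agree-sym (coh y≺x pq∈ λ z z⊀y _ → fy z z⊀y)

  -- `jump` starts from the entry at the common threshold `x`, to which coherence carries every
  -- conditional whose antecedent stays false.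
  next-exists : {t : Vec ℕ k → Formula} → Good t → ∃ (Next t)
  next-exists {t = t} good with eventuallyFalse t Φ
  ... | E , x , fwd , bwd with jump Φ (Good.isState good x) E (proj₁ ∘ fwd)
  ... | y , y-state , agree , prog = y , record
    { isState  = y-state
    ; coherent = λ pq∈ f → let p∈E = bwd (antecedent pq∈) (_ , f) in
        agree-trans (back pq∈ f) (agree p∈E pq∈)
    ; progress = progress prog
    }
    where
    back : ∀ {x′ p q} → (p > q) ∈ˡ Φ → FalseFrom t p x′ → Agree (t x′) (t x) (p > q)
    back pq∈ f = coherentFrom (Good.coherent good) pq∈ f (proj₂ (fwd (bwd (antecedent pq∈) (_ , f))))

    progress : ((∀ {p q} → p ∈ˡ E → t x ⊩ (p > q)) ⊎ ∃[ p ] p ∈ˡ E × y ⊩ p) →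
               Complete t ⊎ ∃[ p ] p ∈ˡ Φ × ∃ (FalseFrom t p) × y ⊩ p
    progress (inj₁ all) = inj₁ λ _ _ _ pq∈ f →
      proj₂ (back pq∈ f) (all (bwd (antecedent pq∈) (_ , f)))
    progress (inj₂ (p , p∈E , y⊩p)) = let p∈Φ , f = fwd p∈E in
      inj₂ (p , p∈Φ , (x , f) , y⊩p)

  -- The choice is a function of `t`, so blocks with equal first states are continued alike, on
  -- which finiteness depends. The default `⊥ᶠ` never arises for a good `t`.
  continue : (Vec ℕ k → Formula) → Formula
  continue t with em {P = ∃ (Next t)}
  ... | yes (y , _) = y
  ... | no _        = ⊥ᶠ

  continue-next : {t : Vec ℕ k → Formula} → Good t → Next t (continue t)
  continue-next {t = t} good with em {P = ∃ (Next t)}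
  ... | yes (_ , isNext) = isNext
  ... | no none          = contradiction (next-exists good) none

  mutual
    -- ω ^ (k + 1) consists of ω blocks of length ω ^ k, each of which
    -- depends only on its first state.
    run : ∀ k → Formula → Vec ℕ k → Formula
    run zero    d []      = d
    run (suc k) d (a ∷ x) = run k (blockStart k d a) x

    blockStart : ∀ k → Formula → ℕ → Formula
    blockStart k d a = fold d (λ e → continue (run k e)) a

  run-origin : ∀ k d → run k d origin ≡ d
  run-origin zero    d = refl
  run-origin (suc k) d = run-origin k d

  module Blocks (k : ℕ) (d : Formula) (good : ∀ a → Good (run k (blockStart k d a))) where

    start : ℕ → Formula
    start = blockStart k d

    block : ℕ → Vec ℕ k → Formula
    block a = run k (start a)

    block-next : ∀ a → Next (block a) (start (suc a))
    block-next a = continue-next (good a)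

    block-falseFrom : ∀ {p a b x y} → a ℕ.< b → FalseOn (run (suc k) d) p (a ∷ x) (b ∷ y) →
                      FalseFrom (block a) p x
    block-falseFrom a<b f z z⊀x = f (_ ∷ z) (tail-⊀ z⊀x) (this a<b refl)

    -- Induction on the blocks crossed: `Next` leads from block `a` to the start of the following
    -- block, then from the start of each wholly crossed block to the next start.
    coherent-start : ∀ {p q a b x y} → (p > q) ∈ˡ Φ → suc a ≤′ b →
                     FalseOn (run (suc k) d) p (a ∷ x) (b ∷ y) → Agree (block a x) (start b) (p > q)
    coherent-start {a = a} pq∈ ≤′-refl f =
      Next.coherent (block-next a) pq∈ (block-falseFrom ℕ.≤-refl f)
    coherent-start {p} {q} {a} {suc b} {x} {y} pq∈ (≤′-step a<b) f = agree-trans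
      (coherent-start {y = y} pq∈ a<b λ z z⊀x z≺ → f z z⊀x (≺-trans z≺ (this ℕ.≤-refl refl)))
      (subst (λ e → Agree e (start (suc b)) (p > q)) (run-origin k (start b))
        (Next.coherent (block-next b) pq∈ λ z _ → f (b ∷ z)
          (λ { (this b<a _) → ℕ.<-asym b<a (ℕ.≤′⇒≤ a<b)
             ; (next b≡a _) → ℕ.<-irrefl (sym b≡a) (ℕ.≤′⇒≤ a<b) })
          (this ℕ.≤-refl refl)))

    coherent : Coherent (run (suc k) d)
    coherent {a ∷ x} {.a ∷ y} (next refl x≺y) pq∈ f = Good.coherent (good a) x≺y pq∈
      λ z z⊀x z≺y → f (a ∷ z) (tail-⊀ z⊀x) (next refl z≺y)
    -- First cross to the start of block `b`, then use coherence inside that block up to `y`.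
    coherent {a ∷ x} {b ∷ y} (this a<b _) {p} {q} pq∈ f = agree-trans
      (coherent-start pq∈ (ℕ.≤⇒≤′ a<b) f) (within y f)
      where
      within : ∀ y → FalseOn (run (suc k) d) p (a ∷ x) (b ∷ y) → Agree (start b) (block b y) (p > q)
      within y f with ≺-compare origin y
      ... | tri> _ _ y≺0 = contradiction y≺0 (⊀-origin y)
      ... | tri≈ _ refl _ rewrite run-origin k (start b) = agree-refl
      ... | tri< 0≺y _ _ = subst (λ e → Agree e (block b y) (p > q)) (run-origin k (start b))
        (Good.coherent (good b) 0≺y pq∈ λ z _ z≺y → f (b ∷ z)
          (λ { (this b<a _) → ℕ.<-asym b<a a<b ; (next b≡a _) → ℕ.<-irrefl (sym b≡a) a<b })
          (next refl z≺y))

  run-good : ∀ k {d} → IsState Φ d → Good (run k d)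
  blockStart-isState : ∀ k {d} → IsState Φ d → ∀ a → IsState Φ (blockStart k d a)

  run-good zero    d-state = record
    { isState  = λ { [] → d-state }
    ; coherent = λ { {[]} {[]} x≺y → contradiction x≺y xs≮[] }
    }
  run-good (suc k) d-state = record
    { isState  = λ { (a ∷ x) → Good.isState (run-good k (blockStart-isState k d-state a)) x }
    ; coherent = Blocks.coherent k _ (λ a → run-good k (blockStart-isState k d-state a))
    }
  blockStart-isState k d-state zero    = d-state
  blockStart-isState k d-state (suc a) =
    Next.isState (continue-next (run-good k (blockStart-isState k d-state a)))

  -- Every level at which the run is not complete has one formula fewer that
  -- is eventually false, since the formula witnessing progress recurs.
  complete⊎fewer : ∀ k {d} → IsState Φ d → Complete (run k d) ⊎
    ∃[ F ] (∀ {p} → p ∈ˡ Φ → ∃ (FalseFrom (run k d) p) → p ∈ˡ F) × ∣ F ∣ + k ℕ.≤ ∣ Φ ∣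
  complete⊎fewer zero    d-state = inj₂ (Φ , (λ p∈ _ → p∈) , ℕ.≤-reflexive (ℕ.+-identityʳ _))
  complete⊎fewer (suc k) {d} d-state with em {P = ∃[ a ] ∀ b → a ℕ.≤ b → ¬ Complete (run k (blockStart k d b))}
  ... | no cofinal = inj₁ complete
    where
    open Blocks k d (λ a → run-good k (blockStart-isState k d-state a))

    complete : Complete (run (suc k) d)
    complete (a ∷ x) p q pq∈ f with em {P = ∃[ b ] a ℕ.< b × Complete (block b)}
    ... | no none = contradiction (suc a , λ b a<b c → none (b , a<b , c)) cofinal
    -- The conditional is vacuous from the start of the complete block `b`, hence provable there,
    -- and coherence carries it back to `a ∷ x`.
    ... | yes (b , a<b , c) = proj₂ (coherent (this a<b refl) pq∈ λ z z⊀ _ → f z z⊀)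
      (c origin p q pq∈ λ z _ → f (b ∷ z)
        (λ { (this b<a _) → ℕ.<-asym b<a a<b ; (next b≡a _) → ℕ.<-irrefl (sym b≡a) a<b }))
  ... | yes (a , incomplete) with eventuallyFalse (run (suc k) d) Φ
  -- Block `a ⊔ suc c` is incomplete because its index is at least `a`; since it lies beyond block
  -- `c`, every formula of `E` is false in it and ever after.
  ... | E , c ∷ x , fwd , bwd with complete⊎fewer k (blockStart-isState k d-state (a ℕ.⊔ suc c))
                                 | Next.progress (continue-next (run-good k (blockStart-isState k d-state (a ℕ.⊔ suc c))))
  ... | inj₁ comp | _ = contradiction comp (incomplete _ (ℕ.m≤m⊔n a (suc c)))
  ... | inj₂ _ | inj₁ comp = contradiction comp (incomplete _ (ℕ.m≤m⊔n a (suc c)))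
  ... | inj₂ (F , covers , ∣F∣) | inj₂ (p , p∈Φ , p-false , y⊩p) with remove (covers p∈Φ p-false)
  ... | F′ , eq , keep = inj₂ (F′ , (λ {q} q∈Φ q-false →
          let _ , f = fwd (bwd q∈Φ q-false) in
          keep (covers q∈Φ (origin , λ z _ → f (b ∷ z) (after z (ℕ.m≤n⊔m a (suc c)))))
            λ { refl → f (suc b ∷ origin) (after origin (ℕ.m≤n⇒m≤1+n (ℕ.m≤n⊔m a (suc c))))
                         (subst (_⊩ p) (sym (run-origin k _)) y⊩p) })
        , subst (ℕ._≤ ∣ Φ ∣) (trans (cong (_+ k) eq) (sym (ℕ.+-suc ∣ F′ ∣ k))) ∣F∣)
    where
    b = a ℕ.⊔ suc c
    after : ∀ {e} z → c ℕ.< e → ¬ ((e ∷ z) ≺ (c ∷ x))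
    after z c<e (this e<c _) = ℕ.<-asym e<c c<e
    after z c<e (next e≡c _) = ℕ.<-irrefl (sym e≡c) c<e

  -- The least level at which `∣ F ∣ + k ≤ ∣ Φ ∣` fails for every `F`, leaving only completeness.
  height : ℕ
  height = suc ∣ Φ ∣

  run-complete : ∀ {d} → IsState Φ d → Complete (run height d)
  run-complete d-state with complete⊎fewer height d-state
  ... | inj₁ comp = comp
  ... | inj₂ (F , _ , ∣F∣) = contradiction (ℕ.≤-trans (ℕ.m≤n+m height ∣ F ∣) ∣F∣) (ℕ.<-irrefl refl)

  -- A tail of a run is determined by the first states of the blocks of each
  -- size in which it begins.
  shifts : ∀ k → List (Vec ℕ k → Formula)
  shifts zero    = map (λ d _ → d) (states Φ)
  shifts (suc k) = cartesianProductWith shift (states Φ) (shifts k)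
    where
    shift : Formula → (Vec ℕ k → Formula) → Vec ℕ (suc k) → Formula
    shift d t (zero ∷ x)  = t x
    shift d t (suc b ∷ x) = run k (blockStart k d (suc b)) x

  -- A shift with leading digit 0 stays inside block `a`, which is the induction hypothesis; a
  -- positive one absorbs the rest of `x`, leaving only the first state of block `a` to matter.
  run-shift : ∀ k {d} → IsState Φ d → ∀ x → ∃[ t ] t ∈ˡ shifts k × (∀ y → run k d (x ⊕ y) ≡ t y)
  run-shift zero {d} d-state [] = _ , ∈-map⁺ (λ d _ → d) (IsState.isConjunction d-state) , λ { [] → refl }
  run-shift (suc k) {d} d-state (a ∷ x) with run-shift k (blockStart-isState k d-state a) x
  ... | t , t∈ , eq = _
    , ∈-cartesianProductWith⁺ _ (IsState.isConjunction (blockStart-isState k d-state a)) t∈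
    , λ { (zero ∷ y) → eq y
        ; (suc b ∷ y) → cong (λ e → run k e y) (fold-+ d (λ e → continue (run k e)) (suc b)) }

-- Canonical models

liftOrdinal : ∀ ℓ → Ordinal 0ℓ → Ordinal ℓ
liftOrdinal ℓ α = record
  { Carrier           = Lift ℓ α.Carrier
  ; _≈_               = λ x y → Lift ℓ (lower x α.≈ lower y)
  ; _<_               = λ x y → Lift ℓ (lower x α.< lower y)
  ; isStrictWellOrder = record
    { isStrictTotalOrder = record
      { isStrictPartialOrder = record
        { isEquivalence = record
          { refl  = lift α.Eq.refl
          ; sym   = λ { (lift e) → lift (α.Eq.sym e) }
          ; trans = λ { (lift e) (lift e′) → lift (α.Eq.trans e e′) }
          }
        ; irrefl   = λ { (lift e) (lift l) → α.irrefl e l }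
        ; trans    = λ { (lift l) (lift l′) → lift (α.trans l l′) }
        ; <-resp-≈ = (λ { (lift e) (lift l) → lift (α.<-respʳ-≈ e l) })
                   , (λ { (lift e) (lift l) → lift (α.<-respˡ-≈ e l) })
        }
      ; compare = λ { (lift x) (lift y) → compare x y }
      }
    ; wellFounded = Subrelation.wellFounded lower (On.wellFounded lower α.wellFounded)
    }
  }
  where
  module α = Ordinal α

  compare : ∀ x y → Tri (Lift ℓ (x α.< y)) (Lift ℓ (x α.≈ y)) (Lift ℓ (y α.< x))
  compare x y with α.compare x y
  ... | tri< a b c = tri< (lift a) (b ∘ lower) (c ∘ lower)
  ... | tri≈ a b c = tri≈ (a ∘ lower) (lift b) (c ∘ lower)
  ... | tri> a b c = tri> (a ∘ lower) (b ∘ lower) (lift c)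

-- The coefficient of `ω ^ n`: the head of a vector of length `suc k` belongs to the power `k`. This
-- maps vectors to the finitely supported functions of `ω^ω`.
digit : Vec ℕ k → ℕ → ℕ
digit []              _ = 0
digit {suc k} (a ∷ x) n with n ℕ.≟ k
... | yes _ = a
... | no _  = digit x n

digit-head : ∀ a (x : Vec ℕ k) → digit (a ∷ x) k ≡ a
digit-head {k} a x with k ℕ.≟ k
... | yes _  = refl
... | no k≢k = contradiction refl k≢k

digit-tail : ∀ a (x : Vec ℕ k) {n} → n ≢ k → digit (a ∷ x) n ≡ digit x n
digit-tail {k} a x {n} n≢k with n ℕ.≟ k
... | yes n≡k = contradiction n≡k n≢k
... | no _    = refl

digit-support : ∀ (x : Vec ℕ k) n → k ℕ.≤ n → digit x n ≡ 0
digit-support []      n _   = refl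
digit-support (a ∷ x) n k<n = trans (digit-tail a x (ℕ.>⇒≢ k<n)) (digit-support x n (ℕ.<⇒≤ k<n))

digit-origin : ∀ k n → digit (origin {k}) n ≡ 0
digit-origin zero    n = refl
digit-origin (suc k) n with n ℕ.≟ k
... | yes _ = refl
... | no _  = digit-origin k n

digit-mono : {x y : Vec ℕ k} → x ≺ y → digit x ω^ω.≺ digit y
digit-mono {zero} {[]} {[]} x≺y = contradiction x≺y xs≮[]
digit-mono {suc k} {a ∷ x} {b ∷ y} (this a<b _) =
  k , subst (ℕ._< digit (b ∷ y) k) (sym (digit-head a x)) (subst (a ℕ.<_) (sym (digit-head b y)) a<b)
  , λ m k<m → trans (digit-support (a ∷ x) m k<m) (sym (digit-support (b ∷ y) m k<m))
digit-mono {suc k} {a ∷ x} {a ∷ y} (next refl x≺y) with digit-mono x≺y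
... | n , lt , es = n
  , subst (ℕ._< digit (a ∷ y) n) (sym (digit-tail a x n≢k)) (subst (digit x n ℕ.<_) (sym (digit-tail a y n≢k)) lt)
  , agree
  where
  n≢k : n ≢ k
  n≢k refl = contradiction (subst (digit x n ℕ.<_) (digit-support y n ℕ.≤-refl) lt) λ ()

  agree : ∀ m → n ℕ.< m → digit (a ∷ x) m ≡ digit (a ∷ y) m
  agree m n<m with m ℕ.≟ k
  ... | yes _ = refl
  ... | no _  = es m n<m

digits : ∀ k → (ℕ → ℕ) → Vec ℕ k
digits zero    f = []
digits (suc k) f = f k ∷ digits k f

digit-digits : ∀ k f {n} → n ℕ.< k → digit (digits k f) n ≡ f n
digit-digits (suc k) f {n} n<1+k with n ℕ.≟ k
... | yes refl = refl
... | no n≢k   = digit-digits k f (ℕ.≤∧≢⇒< (ℕ.≤-pred n<1+k) n≢k)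

-- The witness `bound` is the function for `ω ^ k` itself; exactly the functions vanishing from `k`
-- on lie below it.
≅ω^⇒<ω^ω : ∀ (α : Ordinal ℓ) k → α ≅ liftOrdinal ℓ (ω^ k) → α <ᴼ ω^ω
≅ω^⇒<ω^ω α k i = bound , strictMono⇒≅ α (initial ω^ω bound)
  -- A leading 0 pads `x` to the length of `1 ∷ origin`, so that the two can be compared.
  (λ s → let x = lower (to s) in
    (digit (0 ∷ x) , suc k , digit-support (0 ∷ x)) , digit-mono {x = 0 ∷ x} {1 ∷ origin} (this (s≤s z≤n) refl))
  (λ e n → cong (λ x → digit (0 ∷ x) n) (Pointwise-≡⇒≡ (lower (I.cong e))))
  (λ l → digit-mono (next refl (lower (I.mono l))))
  onto
  where
  open _≅_ i using (to)
  module I = IsOrderIsomorphism (_≅_.isOrderIsomorphism i)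

  bound : Ordinal.Carrier ω^ω
  bound = digit (1 ∷ origin {k}) , suc k , digit-support (1 ∷ origin)

  vanishes : ∀ f → f ω^ω.≺ digit (1 ∷ origin {k}) → ∀ n → k ℕ.≤ n → f n ≡ 0
  vanishes f (n , lt , es) m k≤m with ℕ.<-cmp n k
  ... | tri< n<k n≢k _ = contradiction
    (subst (f n ℕ.<_) (trans (digit-tail 1 (origin {k}) n≢k) (digit-origin k n)) lt) λ ()
  ... | tri> _ _ k<n = contradiction (subst (f n ℕ.<_) (digit-support (1 ∷ origin {k}) n k<n) lt) λ ()
  ... | tri≈ _ refl _ with ℕ.m≤n⇒m<n∨m≡n k≤m
  ... | inj₁ k<m  = trans (es m k<m) (digit-support (1 ∷ origin {k}) m k<m)
  ... | inj₂ refl = ℕ.n<1⇒n≡0 (subst (f k ℕ.<_) (digit-head 1 (origin {k})) lt)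

  onto : ∀ (y : Ordinal.Carrier (initial ω^ω bound)) →
         ∃[ s ] (∀ n → digit (0 ∷ lower (to s)) n ≡ proj₁ (proj₁ y) n)
  onto ((f , _) , f≺) with I.surjective (lift (digits k f))
  ... | s , to-s = s , λ n →
    trans (cong (λ x → digit (0 ∷ x) n) (Pointwise-≡⇒≡ (lower (to-s (Ordinal.Eq.refl α))))) (eq n)
    where
    eq : ∀ n → digit (0 ∷ digits k f) n ≡ f n
    eq n with n ℕ.≟ k
    ... | yes refl = sym (vanishes f f≺ n ℕ.≤-refl)
    ... | no n≢k with ℕ.<-cmp n k
    ... | tri< n<k _ _ = digit-digits k f n<k
    ... | tri≈ _ n≡k _ = contradiction n≡k n≢k
    ... | tri> _ _ k<n = trans (digit-support (digits k f) n (ℕ.<⇒≤ k<n)) (sym (vanishes f f≺ n (ℕ.<⇒≤ k<n)))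

-- Runs as ordinal sequences

module _ {ℓ : Level} where

  toSequence : (Vec ℕ k → Formula) → Sequence (Lift ℓ Formula)
  toSequence {k} t = record
    { length = liftOrdinal ℓ (ω^ k)
    ; values = record
      { to   = λ x → lift (t (lower x))
      ; cong = λ { (lift e) → cong (lift ∘ t) (Pointwise-≡⇒≡ e) }
      }
    }

  tailFrom : (Vec ℕ k → Formula) → Vec ℕ k → Sequence (Lift ℓ Formula)
  tailFrom t x = toSequence t [ [ lift x ] :]

  -- Powers of ω are additively indecomposable: `x ⊕_` maps `ω ^ k` isomorphically onto the
  -- positions from `x` on, so this tail has length `ω ^ k` again.
  ⊕-tail : ∀ (t : Vec ℕ k → Formula) x t′ → (∀ y → t (x ⊕ y) ≡ t′ y) → toSequence t′ ≋ tailFrom t x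
  ⊕-tail t x t′ eq =
    strictMono⇒≅ _ _
      (λ { (lift y) → lift (x ⊕ y) , λ { SupStrict.[ lift l ] → ⊕-⊀ x y l } })
      (λ { (lift e) → lift (≡⇒Pointwise-≡ (cong (x ⊕_) (Pointwise-≡⇒≡ e))) })
      (λ { (lift l) → lift (⊕-mono x l) })
      (λ { (lift y , y⊀x) → let z , e = ⊕-onto x y (λ l → y⊀x SupStrict.[ lift l ]) in
           lift z , lift (≡⇒Pointwise-≡ e) })
    , λ { (lift y) → cong lift (sym (eq y)) }

  -- The valuation must respect `≋`, so it reads atoms off the least position of a sequence and not
  -- off the run that the sequence comes from.
  StartsWith : Formula → Pred (Sequence (Lift ℓ Formula)) ℓ
  StartsWith p σ = ∃[ x ] (∀ y → ¬ Ordinal._<_ (length σ) y x) × lower (values σ ⟨$⟩ x) ⊩ p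

  startsWith-resp : ∀ p σ τ → σ ≋ τ → StartsWith p σ → StartsWith p τ
  startsWith-resp p σ τ (i , e) (x , least , x⊩p) = _≅_.to i x
    , (λ y y<ix → let z , iz≈y = I.surjective y in least z (I.cancel
        (Ordinal.<-respˡ-≈ (length τ) (Ordinal.Eq.sym (length τ) (iz≈y (Ordinal.Eq.refl (length σ)))) y<ix)))
    , subst (λ v → lower v ⊩ p) (e x) x⊩p
    where module I = IsOrderIsomorphism (_≅_.isOrderIsomorphism i)

  startsWith-tail⁺ : ∀ p (t : Vec ℕ k → Formula) x → t x ⊩ p → StartsWith p (tailFrom t x)
  startsWith-tail⁺ p t x tx⊩p = (lift x , λ { SupStrict.[ lift l ] → ≺-irrefl l })
    , (λ { (y , y⊀x) y≺x → y⊀x SupStrict.[ y≺x ] }) , tx⊩p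

  startsWith-tail⁻ : ∀ p (t : Vec ℕ k → Formula) x → StartsWith p (tailFrom t x) → t x ⊩ p
  startsWith-tail⁻ p t x ((lift y , y⊀x) , least , ty⊩p) with ≺-compare x y
  ... | tri< x≺y _ _ = contradiction (lift x≺y) (least (lift x , λ { SupStrict.[ lift l ] → ≺-irrefl l }))
  ... | tri≈ _ refl _ = ty⊩p
  ... | tri> _ _ y≺x = contradiction SupStrict.[ lift y≺x ] y⊀x

-- Subformulas

infix 4 _◁_

data _◁_ : Formula → Formula → Set where
  ∼-sub  : ∀ {p} → p ◁ ∼ p
  ∧-subˡ : ∀ {p q} → p ◁ p ∧ q
  ∧-subʳ : ∀ {p q} → q ◁ p ∧ q
  >-subˡ : ∀ {p q} → p ◁ p > q
  >-subʳ : ∀ {p q} → q ◁ p > q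

mutual
  subformulas properSubformulas : Formula → List Formula
  subformulas p = p ∷ properSubformulas p

  properSubformulas (atom _) = []
  properSubformulas (∼ p)    = subformulas p
  properSubformulas (p ∧ q)  = subformulas p ++ subformulas q
  properSubformulas (p > q)  = subformulas p ++ subformulas q

subformulas-closed : ∀ φ {p q} → q ∈ˡ subformulas φ → p ◁ q → p ∈ˡ subformulas φ
properSubformulas-closed : ∀ φ {p q} → q ∈ˡ properSubformulas φ → p ◁ q → p ∈ˡ properSubformulas φ
++-closed : ∀ φ ψ {p q} → q ∈ˡ subformulas φ ++ subformulas ψ → p ◁ q → p ∈ˡ subformulas φ ++ subformulas ψ

subformulas-closed φ       (there q∈)  p◁q    = there (properSubformulas-closed φ q∈ p◁q)
subformulas-closed (∼ p)   (here refl) ∼-sub  = there (here refl)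
subformulas-closed (p ∧ q) (here refl) ∧-subˡ = there (here refl)
subformulas-closed (p ∧ q) (here refl) ∧-subʳ = there (∈-++⁺ʳ (subformulas p) (here refl))
subformulas-closed (p > q) (here refl) >-subˡ = there (here refl)
subformulas-closed (p > q) (here refl) >-subʳ = there (∈-++⁺ʳ (subformulas p) (here refl))

properSubformulas-closed (∼ p)   = subformulas-closed p
properSubformulas-closed (p ∧ q) = ++-closed p q
properSubformulas-closed (p > q) = ++-closed p q

++-closed φ ψ q∈ p◁q with ∈-++⁻ (subformulas φ) q∈
... | inj₁ q∈φ = ∈-++⁺ˡ (subformulas-closed φ q∈φ p◁q)
... | inj₂ q∈ψ = ∈-++⁺ʳ (subformulas φ) (subformulas-closed ψ q∈ψ p◁q)

-- The model of all tails of runs, and its truth lemma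

module Canonical (em : ∀ {a} → ExcludedMiddle a) (ℓ : Level) (φ : Formula) where

  Φ : List Formula
  Φ = subformulas φ

  closed : ∀ {p q} → q ∈ˡ Φ → p ◁ q → p ∈ˡ Φ
  closed = subformulas-closed φ

  open Classical em
  open Lindenbaum em
  open Construction em Φ (λ pq∈ → closed pq∈ >-subˡ)

  runTail : Formula → Vec ℕ height → Sequence (Lift ℓ Formula)
  runTail d = tailFrom (run height d)

  W : Pred (Sequence (Lift ℓ Formula)) (lsuc ℓ)
  W σ = Lift (lsuc ℓ) (∃[ d ] IsState Φ d × ∃[ x ] σ ≋ runTail d x)

  runTail∈W : ∀ {d} → IsState Φ d → ∀ x → W (runTail d x)
  runTail∈W {d} d-state x = lift (d , d-state , x , ≋-refl {σ = runTail d x})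

  module _ {d₀ : Formula} (d₀-state : IsState Φ d₀) where

    model : OrdinalSequenceModel ℓ
    model = record
      { P            = Lift ℓ Formula
      ; P-nonEmpty   = lift φ
      ; W            = W
      ; W-respects   = λ { {σ} {τ} σ≋τ (lift (d , d-state , x , σ≋)) →
                           lift (d , d-state , x , ≋-trans′ τ σ (runTail d x) (≋-sym′ σ τ σ≋τ) σ≋) }
      ; isOrderFrame = tailOrder-isOrderFrame W (runTail d₀ origin , runTail∈W d₀-state origin)
      ; V            = λ k w → does (em {P = StartsWith (atom k) (proj₁ w)})
      ; V-cong       = λ k {w} {w′} → V-cong k (proj₁ w) (proj₁ w′)
      }
      where
      V-cong : ∀ k σ τ → σ ≋ τ →
               does (em {P = StartsWith (atom k) σ}) ≡ does (em {P = StartsWith (atom k) τ})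
      V-cong k σ τ σ≋τ with em {P = StartsWith (atom k) σ} | em {P = StartsWith (atom k) τ}
      ... | yes _  | yes _  = refl
      ... | yes s  | no ¬s  = contradiction (startsWith-resp (atom k) σ τ σ≋τ s) ¬s
      ... | no ¬s  | yes s  = contradiction (startsWith-resp (atom k) τ σ (≋-sym′ σ τ σ≋τ) s) ¬s
      ... | no _   | no _   = refl

    open Truth model
    open OrderModel (OrdinalSequenceModel.orderModel model) using (⟦_⟧)

    -- By `run-shift` every member equals `toSequence t` for some `t` in the list `shifts height`;
    -- excluded middle selects those that lie in `W`.
    finite : Finite model
    finite = let worlds , enum = enumerate (shifts height) in worlds , λ {
      (σ , lift (d , d-state , x , σ≋)) →
        let t , t∈ , eq = run-shift height d-state x in
        enum (σ , lift (d , d-state , x , σ≋)) t∈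
          (≋-trans′ σ (runTail d x) (toSequence t) σ≋
            (≋-sym′ (toSequence t) (runTail d x) (⊕-tail (run height d) x t eq))) }
      where
      enumerate : (ts : List (Vec ℕ height → Formula)) → Σ[ worlds ∈ List (∃ W) ]
        (∀ (w : ∃ W) {t} → t ∈ˡ ts → proj₁ w ≋ toSequence t → Any (λ v → proj₁ w ≋ proj₁ v) worlds)
      enumerate [] = [] , λ _ ()
      enumerate (t ∷ ts) with enumerate ts | em {P = W (toSequence t)}
      ... | ws , enum | yes t∈W = (toSequence t , t∈W) ∷ ws , λ where
        w (here refl) w≋ → here w≋
        w (there t∈)  w≋ → there (enum w t∈ w≋)
      ... | ws , enum | no t∉W = ws , λ where
        w (here refl) w≋ → contradiction (OrdinalSequenceModel.W-respects model {proj₁ w} {toSequence t} w≋ (proj₂ w)) t∉W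
        w (there t∈)  w≋ → enum w t∈ w≋

    tail-of : ∀ d x y y⊀x → runTail d x [ [ lift y , y⊀x ] :] ≋ runTail d y
    tail-of d x y y⊀x = tail-tail (toSequence (run height d)) [ lift x ] [ lift y , y⊀x ]

    nonEmptyTail : ∀ d x (β : Ordinal.Cut (length (runTail d x))) → NonEmpty (runTail d x [ β :]) →
                   ∃[ y ] runTail d x [ β :] ≋ runTail d y
    nonEmptyTail d x [ lift y , y⊀x ] _ = y , tail-of d x y y⊀x
    nonEmptyTail d x ⊤⁺ (y , y≮⊤) = contradiction SupStrict.[ y ]<⊤⁺ y≮⊤

    closedUnderTails : ClosedUnderNonEmptyTails model
    closedUnderTails σ (lift (d , d-state , x , i)) β (s , s≮β) =
      let i′ = mapCut {σ = σ} {runTail d x} i β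
          e  = tail-resp {σ = σ} {runTail d x} i β
          y , e′ = nonEmptyTail d x i′ (_≅_.to (proj₁ e) (s , s≮β))
      in lift (d , d-state , y , ≋-trans′ (σ [ β :]) (runTail d x [ i′ :]) (runTail d y) e e′)

    lengthsBelow : LengthsBelow model ω^ω
    lengthsBelow σ (lift (d , d-state , x , σ≋)) = ≅ω^⇒<ω^ω (length σ) height
      (proj₁ (≋-trans′ σ (runTail d x) (toSequence (run height d ∘ (x ⊕_))) σ≋
        (≋-sym′ (toSequence (run height d ∘ (x ⊕_))) (runTail d x) (⊕-tail (run height d) x _ λ _ → refl))))

    nonEmpty : ∀ σ → W σ → NonEmpty σ
    nonEmpty σ (lift (d , _ , x , σ≋)) =
      _≅_.to (proj₁ (≋-sym′ σ (runTail d x) σ≋)) (lift x , λ { SupStrict.[ lift l ] → ≺-irrefl l })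

    -- Both directions go by simultaneous induction because negation exchanges them. For `p > q`,
    -- coherence links `x` with the first entry `y` from `x` on that proves `p`; there MP and
    -- `>-centering` relate the conditional to `q`.
    truth⁺ : ∀ p → p ∈ˡ Φ → ∀ {d} (s : IsState Φ d) x → run height d x ⊩ p →
             ⟦ p ⟧ (runTail d x , runTail∈W s x)
    truth⁻ : ∀ p → p ∈ˡ Φ → ∀ {d} (s : IsState Φ d) x →
             ⟦ p ⟧ (runTail d x , runTail∈W s x) → run height d x ⊩ p

    truth⁻-tail : ∀ p → p ∈ˡ Φ → ∀ {d} → IsState Φ d → ∀ σ y → σ ≋ runTail d y →
                  ⟪ p ⟫ σ → run height d y ⊩ p
    truth⁻-tail p p∈ {d} s σ y σ≋ pσ with ⟪⟫-resp p σ (runTail d y) σ≋ pσ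
    ... | u , py = truth⁻ p p∈ s y (⟦⟧-resp p (runTail d y , u) (runTail d y , runTail∈W s y) (≋-refl {σ = runTail d y}) py)

    truth⁺-tail : ∀ p → p ∈ˡ Φ → ∀ {d} → IsState Φ d → ∀ σ y → σ ≋ runTail d y →
                  run height d y ⊩ p → ⟪ p ⟫ σ
    truth⁺-tail p p∈ {d} s σ y σ≋ y⊩p =
      ⟪⟫-resp p (runTail d y) σ (≋-sym′ σ (runTail d y) σ≋) (runTail∈W s y , truth⁺ p p∈ s y y⊩p)

    agreeUntil : ∀ {p q d} → IsState Φ d → (p > q) ∈ˡ Φ → ∀ x y → ¬ (y ≺ x) →
                 FalseOn (run height d) p x y → Agree (run height d x) (run height d y) (p > q)
    agreeUntil s pq∈ x y y⊀x f with ≺-compare x y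
    ... | tri< x≺y _ _ = Good.coherent (run-good height s) x≺y pq∈ f
    ... | tri≈ _ refl _ = agree-refl
    ... | tri> _ _ y≺x = contradiction y≺x y⊀x

    truth⁺ (atom k) p∈ {d} s x x⊩p with em {P = StartsWith (atom k) (runTail d x)}
    ... | yes _ = lift refl
    ... | no ¬s = contradiction (startsWith-tail⁺ (atom k) (run height d) x x⊩p) ¬s
    truth⁺ (∼ p) p∈ s x x⊩ h = IsState.excludes (Good.isState (run-good height s) x)
      (truth⁻ p (closed p∈ ∼-sub) s x h) x⊩
    truth⁺ (p ∧ q) pq∈ {d} s x x⊩ =
      truth⁺ p (closed pq∈ ∧-subˡ) s x (Theory.mp th (Theory.thm th (taut (conj x₀ x₁ ⟶ x₀) p q q q)) x⊩) ,
      truth⁺ q (closed pq∈ ∧-subʳ) s x (Theory.mp th (Theory.thm th (taut (conj x₀ x₁ ⟶ x₁) p q q q)) x⊩)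
      where th = given (run height d x)
    truth⁺ (p > q) pq∈ {d} s x x⊩ = >-intro p q (runTail d x , runTail∈W s x) λ {
      [ lift y , y⊀x ] (py , least) →
        let y⊩p = truth⁻-tail p p∈ s _ y (tail-of d x y y⊀x) py
            y⊩pq = proj₁ (agreeUntil s pq∈ x y (λ l → y⊀x SupStrict.[ lift l ]) λ z z⊀x z≺y z⊩p →
              let z⊀x′ = λ { SupStrict.[ lift l ] → z⊀x l } in
              least [ lift z , z⊀x′ ] SupStrict.[ lift z≺y ]
                (truth⁺-tail p p∈ s _ z (tail-of d x z z⊀x′) z⊩p)) x⊩
        in truth⁺-tail q (closed pq∈ >-subʳ) s _ y (tail-of d x y y⊀x)
             (Consequents.>-modusPonens (given (run height d y)) y⊩pq y⊩p) ;
      -- The tail at `⊤⁺` is empty, whereas members of `W` are not.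
      ⊤⁺ ((u , _) , _) → contradiction (nonEmpty (runTail d x [ ⊤⁺ :]) u) λ (z , z≮⊤) → z≮⊤ SupStrict.[ z ]<⊤⁺ }
      where
      p∈ = closed pq∈ >-subˡ

    truth⁻ (atom k) p∈ {d} s x (lift h) with em {P = StartsWith (atom k) (runTail d x)}
    ... | yes w = startsWith-tail⁻ (atom k) (run height d) x w
    truth⁻ (∼ p) p∈ s x h = IsState.negates (Good.isState (run-good height s) x) (closed p∈ ∼-sub)
      (h ∘ truth⁺ p (closed p∈ ∼-sub) s x)
    truth⁻ (p ∧ q) pq∈ {d} s x (px , qx) = Theory.∧-intro (given (run height d x))
      (truth⁻ p (closed pq∈ ∧-subˡ) s x px) (truth⁻ q (closed pq∈ ∧-subʳ) s x qx)
    truth⁻ (p > q) pq∈ {d} s x h with em {P = ∃[ y ] ¬ (y ≺ x) × run height d y ⊩ p}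
    -- No entry from `x` on proves `p`, so the conditional is vacuous and its provability is the
    -- completeness of the run.
    ... | no none = run-complete s x p q pq∈ λ y y⊀x y⊩p → none (y , y⊀x , y⊩p)
    ... | yes some with minimal (Ordinal.wellFounded (ω^ height)) (λ y → ¬ (y ≺ x) × run height d y ⊩ p) some
    ... | y , (y⊀x , y⊩p) , least =
      proj₂ (agreeUntil s pq∈ x y y⊀x λ z z⊀x z≺y z⊩p → least z z≺y (z⊀x , z⊩p))
        (Consequents.>-centering (given (run height d y)) y⊩p
          (truth⁻-tail q (closed pq∈ >-subʳ) s _ y (tail-of d x y y⊀x′)
            (>-elim p q (runTail d x , runTail∈W s x) h [ lift y , y⊀x′ ]
              (truth⁺-tail p p∈ s _ y (tail-of d x y y⊀x′) y⊩p , first-y))))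
      where
      p∈ = closed pq∈ >-subˡ
      y⊀x′ : ¬ (Ordinal._<⁺_ (length (toSequence {ℓ} (run height d))) [ lift y ] [ lift x ])
      y⊀x′ SupStrict.[ lift l ] = y⊀x l
      first-y : ∀ γ → Ordinal._<⁺_ (length (runTail d x)) γ [ lift y , y⊀x′ ] → ¬ ⟪ p ⟫ (runTail d x [ γ :])
      first-y [ lift z , z⊀x ] SupStrict.[ lift z≺y ] pz =
        least z z≺y ((λ l → z⊀x SupStrict.[ lift l ]) , truth⁻-tail p p∈ s _ z (tail-of d x z z⊀x) pz)

  -- If `φ` is unprovable, some state `d` is consistent with `∼ φ`; truth of `φ` at the start of its
  -- run would give `d ⊩ φ`, hence `∼ φ ⊩ (∼ d)`.
  complete : ((M : OrdinalSequenceModel ℓ) → Finite M → ClosedUnderNonEmptyTails M →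
              LengthsBelow M ω^ω → TrueAtEvery M φ) → ⊢C2F φ
  complete h with em {P = ⊢C2F φ}
  ... | yes ⊢φ = ⊢φ
  ... | no ⊬φ with lindenbaum (given (∼ φ)) (λ ∼φ⊩⊥ → ⊬φ (Theory.mp theorems
        (taut ((neg x₀ ⟶ conj x₁ (neg x₁)) ⟶ x₀) φ (atom 0) φ φ) ∼φ⊩⊥)) Φ
  ... | d , d∈ , ∼φ⊮∼d = contradiction (contrapose (Theory.mp (given d)
          (Theory.thm (given d) (taut (x₀ ⟶ neg (neg x₀)) φ φ φ φ)) d⊩φ)) ∼φ⊮∼d
    where
    d-state : IsState Φ d
    d-state = record { isConjunction = d∈ ; consistent = λ ⊢∼d → ∼φ⊮∼d (Theory.thm (given (∼ φ)) ⊢∼d) }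

    d⊩φ : d ⊩ φ
    d⊩φ = subst (_⊩ φ) (run-origin height d) (truth⁻ d-state φ (here refl) d-state origin
      (h (model d-state) (finite d-state) (closedUnderTails d-state) (lengthsBelow d-state) _))

theorem6p2 : (∀ {a} → ExcludedMiddle a) → ∀ {ℓ} →
    (∀ p → ⊢C2F p → (M : OrdinalSequenceModel ℓ) → TrueAtEvery M p)
    × (∀ p → ((M : OrdinalSequenceModel ℓ) → Finite M → ClosedUnderNonEmptyTails M →
    LengthsBelow M ω^ω → TrueAtEvery M p) → ⊢C2F p)
theorem6p2 em {ℓ} =
  (λ p ⊢p M → Classical.Truth.sound em M ⊢p) , λ p → Canonical.complete em ℓ p
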